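{- For all integers $2\le d\le t$, the graph $H_{t,d}$ has BEL gadgets.
   Context: All graphs are finite and simple; a copy of a graph means a (not necessarily induced) subgraph isomorphic to it. For graphs $F,H$, write $F\to H$ if every 2-coloring (red/blue) of the edges of $F$ contains a monochromatic copy of $H$, and $F\not\to H$ otherwise. A graph $H$ has BEL gadgets if for every graph $G$ and every 2-coloring $\psi$ of the edges of $G$ without a monochromatic copy of $H$, there is a graph $F$ such that (1) $F\not\to H$, (2) $F$ contains $G$ as an induced subgraph, and (3) for every 2-coloring of the edges of $F$ without a monochromatic copy of $H$, its restriction to $G$ agrees with $\psi$ up to swapping the two colors. For $0\le d\le t$, $H_{t,d}$ is the graph on $t+1$ vertices consisting of a complete graph $K_t$ together with one additional vertex adjacent to exactly $d$ vertices of the $K_t$. -}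

module Defs where

open import Data.Nat using (ℕ; zero; suc; _≡ᵇ_; _<ᵇ_)
open import Data.Fin using (Fin; toℕ)
open import Data.Bool using (Bool; true; false; not; _∧_; _∨_)
open import Data.Bool.Properties using (∨-comm)
open import Data.Product using (Σ; _×_; _,_)
open import Data.Sum using (_⊎_)
open import Relation.Binary.PropositionalEquality using (_≡_; refl; cong₂)
open import Relation.Nullary using (¬_)
open import Function.Definitions using (Injective)

record Graph : Set where
  field
    n     : ℕ
    adj   : Fin n → Fin n → Bool
    sym   : ∀ i j → adj i j ≡ adj j i
    irref : ∀ i → adj i i ≡ false
open Graph public

-- A red/blue 2-coloring of the edges of G: a colour for each unordered pair
-- (only the values on edges matter).  true = red, false = blue.
record Coloring (G : Graph) : Set where
  field
    col    : Fin (n G) → Fin (n G) → Bool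
    colSym : ∀ i j → col i j ≡ col j i
open Coloring public

record Copy (H G : Graph) : Set where
  field
    emb    : Fin (n H) → Fin (n G)
    embInj : Injective _≡_ _≡_ emb
    embHom : ∀ u v → adj H u v ≡ true → adj G (emb u) (emb v) ≡ true
open Copy public

MonoCopy : (H G : Graph) → Coloring G → Set
MonoCopy H G c = Σ (Copy H G) λ f → Σ Bool λ b →
  ∀ u v → adj H u v ≡ true → col c (emb f u) (emb f v) ≡ b

HFree : (H G : Graph) → Coloring G → Set
HFree H G c = ¬ MonoCopy H G c

Arrows : (F H : Graph) → Set
Arrows F H = (c : Coloring F) → MonoCopy H F c

record InducedEmb (G F : Graph) : Set where
  field
    map    : Fin (n G) → Fin (n F)
    mapInj : Injective _≡_ _≡_ map
    mapInd : ∀ i j → adj F (map i) (map j) ≡ adj G i j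
open InducedEmb public

AgreeUpToSwap : (G F : Graph) → InducedEmb G F → Coloring F → Coloring G → Set
AgreeUpToSwap G F g φ ψ =
  (∀ i j → adj G i j ≡ true → col φ (map g i) (map g j) ≡ col ψ i j)
  ⊎ (∀ i j → adj G i j ≡ true → col φ (map g i) (map g j) ≡ not (col ψ i j))

HasBELGadgets : Graph → Set
HasBELGadgets H =
  (G : Graph) (ψ : Coloring G) → HFree H G ψ →
  Σ Graph λ F →
    ¬ Arrows F H ×
    Σ (InducedEmb G F) λ g →
      ((φ : Coloring F) → HFree H F φ → AgreeUpToSwap G F g φ ψ)

≡ᵇ-sym : ∀ a b → (a ≡ᵇ b) ≡ (b ≡ᵇ a)
≡ᵇ-sym zero zero = refl
≡ᵇ-sym zero (suc b) = refl
≡ᵇ-sym (suc a) zero = refl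
≡ᵇ-sym (suc a) (suc b) = ≡ᵇ-sym a b

≡ᵇ-refl : ∀ a → (a ≡ᵇ a) ≡ true
≡ᵇ-refl zero = refl
≡ᵇ-refl (suc a) = ≡ᵇ-refl a

symClose : (m : ℕ) → (Fin m → Fin m → Bool) → Graph
symClose m r = record
  { n = m
  ; adj = λ i j → not (toℕ i ≡ᵇ toℕ j) ∧ (r i j ∨ r j i)
  ; sym = λ i j → cong₂ (λ x y → not x ∧ y) (≡ᵇ-sym (toℕ i) (toℕ j)) (∨-comm (r i j) (r j i))
  ; irref = λ i → irr i
  }
  where
  irr : ∀ i → not (toℕ i ≡ᵇ toℕ i) ∧ (r i i ∨ r i i) ≡ false
  irr i with toℕ i ≡ᵇ toℕ i | ≡ᵇ-refl (toℕ i)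
  ... | true | _ = refl

-- H_{t,d}: vertices 0..t; vertices 0..t-1 form K_t, vertex t is adjacent
-- exactly to the vertices 0..d-1 (which are d vertices of the K_t when d ≤ t).
H : ℕ → ℕ → Graph
H t d = symClose (suc t) λ i j →
  ((toℕ i <ᵇ t) ∧ (toℕ j <ᵇ t)) ∨ ((toℕ i ≡ᵇ t) ∧ (toℕ j <ᵇ d))

-- Let m = t + 1 if d = t and m = t otherwise, and let q be maximal such that
-- K_q has a colouring ψ without red K_m and without blue K_{m-1}.  Joining a new
-- vertex to K_q in a single colour shows, by maximality, that every colouring of
-- K_q contains a monochromatic K_{m-1} and, for each colour γ, a K_{m-2} in γ or
-- a K_m in the other colour.
--
-- There is a graph B, coloured without red K_m and without blue K_{m-1}, such
-- that every 16-colouring of its vertices has a copy of K_q inside one class.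
-- Given two edges e, f of the same colour χ, far from each other, join all of B
-- to the four ends in the colour other than χ (and let red mean χ in B).  No
-- monochromatic H arises.  Conversely, given any colouring φ without
-- monochromatic H, 16-colour B by the φ-colours towards the four ends; a K_q in
-- one class together with these ends would contain a monochromatic K_m if
-- φ(e) ≠ φ(f).  If d < t, a K_m is not yet an H, so B is first replaced by a
-- blow-up in which some copy of B has a twin for each of its vertices.
--
-- Finally every edge of G and of a K_{t+1} is linked in this way to one of two
-- reference edges of different colours; the references differ in φ because
-- K_{t+1} is not monochromatic.
module Submission where

open import Defs using (Graph; Coloring; Copy; HFree; InducedEmb; AgreeUpToSwap; HasBELGadgets; H)
import Defs
open import Data.Bool using (Bool; true; false; not; _∧_; _∨_; T)
import Data.Bool.Properties as Boolₚ
open import Data.Bool.Properties using (T-≡; T-∧; T-∨)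
open import Data.Empty using (⊥; ⊥-elim)
open import Data.Fin using (Fin; zero; suc; toℕ; fromℕ; fromℕ<; inject₁; lift; punchIn; punchOut; combine; remQuot; finToFun; funToFin)
import Data.Fin.Properties as Finₚ
open import Data.Fin.Relation.Unary.Top using (View; view; ‵fromℕ; ‵inject₁)
open import Data.List using (List; []; _∷_; allFin) renaming (map to mapᴸ)
open import Data.List.Properties using (map-∘; map-id)
open import Data.List.Membership.Propositional using (_∈_)
open import Data.List.Membership.Propositional.Properties using (∈-map⁺; ∈-allFin)
open import Data.List.Relation.Unary.Any using (here; there)
open import Data.Nat using (ℕ; zero; suc; _+_; _*_; _^_; _≤_; _<_; z≤n; s≤s; _<ᵇ_; _≡ᵇ_)
import Data.Nat.Properties as ℕₚ
open import Data.Product using (Σ; _×_; _,_; proj₁; proj₂)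
open import Data.Product.Function.NonDependent.Propositional using (_×-↔_)
open import Data.Sum using (_⊎_; inj₁; inj₂; [_,_]′)
open import Data.Sum.Properties using (inj₂-injective)
open import Data.Sum.Function.Propositional using (_⊎-↔_)
open import Data.Vec using (Vec; []; _∷_; lookup; tabulate)
import Data.Vec.Properties as Vecₚ
open import Data.Vec.Functional using () renaming (_∷_ to _◂_)
open import Function using (_∘_; id; _↔_; Inverse; Equivalence)
open import Function.Properties.Inverse using (↔-refl; ↔-sym; ↔-trans; ↔⇒↣)
open import Relation.Binary.Definitions using (Symmetric; DecidableEquality)
open import Relation.Binary.PropositionalEquality using (_≡_; _≢_; refl; sym; trans; cong; subst; subst₂)
open import Relation.Nullary using (¬_; Dec; yes; no; does; contradiction)
open import Relation.Nullary.Decidable using (map′; _×-dec_; _→-dec_; ¬?; via-injection)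

-- Ramsey's theorem and extremal colourings of complete graphs

Clique : {V : Set} → (V → V → Set) → ∀ {k} → (Fin k → V) → Set
Clique R g = ∀ i j → i ≢ j → R (g i) (g j)

module _ {V : Set} {R : V → V → Set} where

  ◂-clique : Symmetric R → ∀ {k v} {g : Fin k → V} →
             (∀ i → R v (g i)) → Clique R g → Clique R (v ◂ g)
  ◂-clique R-sym Rv Rg zero    zero    0≢0 = contradiction refl 0≢0
  ◂-clique R-sym Rv Rg zero    (suc j) _   = Rv j
  ◂-clique R-sym Rv Rg (suc i) zero    _   = R-sym (Rv i)
  ◂-clique R-sym Rv Rg (suc i) (suc j) i≢j = Rg i j (i≢j ∘ cong suc)

  clique-∘ : ∀ {k l} {g : Fin k → V} {e : Fin l → Fin k} →
             (∀ {i j} → e i ≡ e j → i ≡ j) → Clique R g → Clique R (g ∘ e)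
  clique-∘ e-inj Rg i j i≢j = Rg _ _ (i≢j ∘ e-inj)

lift-all : ∀ {m n} {P : Fin (suc n) → Set} {e : Fin m → Fin n} →
           P zero → (∀ i → P (suc (e i))) → ∀ i → P (lift 1 e i)
lift-all p₀ p zero    = p₀
lift-all p₀ p (suc i) = p i

-- The size enters through an equation because the recursive calls split it differently: if the
-- first index satisfies `Q`, then `a + suc b` has to be read as `suc a + b`.
pigeonhole₂ : ∀ {n} a b → n ≡ a + b → {P Q : Fin n → Set} → (∀ i → P i ⊎ Q i) →
  (Σ (Fin a → Fin n) λ e → (∀ {i j} → e i ≡ e j → i ≡ j) × (∀ i → P (e i))) ⊎
  (Σ (Fin b → Fin n) λ e → (∀ {i j} → e i ≡ e j → i ≡ j) × (∀ i → Q (e i)))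
pigeonhole₂ zero    b       n≡   PQ = inj₁ ((λ ()) , (λ { {()} }) , λ ())
pigeonhole₂ (suc a) zero    n≡   PQ = inj₂ ((λ ()) , (λ { {()} }) , λ ())
pigeonhole₂ (suc a) (suc b) refl {P} {Q} PQ with PQ zero
... | inj₁ p with pigeonhole₂ a (suc b) refl (PQ ∘ suc)
...   | inj₁ (e , inj , pe) = inj₁ (lift 1 e , Finₚ.lift-injective e inj 1 , lift-all {P = P} p pe)
...   | inj₂ (e , inj , qe) = inj₂ (suc ∘ e , inj ∘ Finₚ.suc-injective , qe)
pigeonhole₂ (suc a) (suc b) refl {P} {Q} PQ | inj₂ q
  with pigeonhole₂ (suc a) b (ℕₚ.+-suc a b) (PQ ∘ suc)
...   | inj₁ (e , inj , pe) = inj₁ (suc ∘ e , inj ∘ Finₚ.suc-injective , pe)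
...   | inj₂ (e , inj , qe) = inj₂ (lift 1 e , Finₚ.lift-injective e inj 1 , lift-all {P = Q} q qe)

-- Induction through the neighbourhood of the first vertex. The number is fixed before the vertex
-- type, so the induction hypothesis applies to the type of vertices joined to the first one in a
-- given colour; its elements carry the edge needed to prefix that vertex to a clique.
ramsey : ∀ a b → Σ ℕ λ N → ∀ {V : Set} {R B : V → V → Set} → Symmetric R → Symmetric B →
  (x : Fin N → V) → Clique (λ u v → R u v ⊎ B u v) x →
  Σ (Fin a → V) (Clique R) ⊎ Σ (Fin b → V) (Clique B)
ramsey zero    b       = 0 , λ _ _ _ _ → inj₁ ((λ ()) , λ ())
ramsey (suc a) zero    = 0 , λ _ _ _ _ → inj₂ ((λ ()) , λ ())
ramsey (suc a) (suc b) with ramsey a (suc b) | ramsey (suc a) b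
... | M , ramM | N , ramN = suc (M + N) , ram
  where
  ram : ∀ {V : Set} {R B : V → V → Set} → Symmetric R → Symmetric B →
    (x : Fin (suc (M + N)) → V) → Clique (λ u v → R u v ⊎ B u v) x →
    Σ (Fin (suc a) → V) (Clique R) ⊎ Σ (Fin (suc b) → V) (Clique B)
  ram {V} {R} {B} R-sym B-sym x cl
    with pigeonhole₂ M N refl {P = λ i → R (x zero) (x (suc i))} {Q = λ i → B (x zero) (x (suc i))}
                     (λ i → cl zero (suc i) (λ ()))
  ... | inj₁ (e , inj , Re)
      with ramM {Σ V (R (x zero))} {λ u v → R (proj₁ u) (proj₁ v)} {λ u v → B (proj₁ u) (proj₁ v)}
             R-sym B-sym (λ i → x (suc (e i)) , Re i)
             (λ i j i≢j → cl _ _ (i≢j ∘ inj ∘ Finₚ.suc-injective))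
  ...   | inj₁ (g , Rg) = inj₁ (x zero ◂ (proj₁ ∘ g) , ◂-clique {R = R} R-sym {g = proj₁ ∘ g} (proj₂ ∘ g) Rg)
  ...   | inj₂ (g , Bg) = inj₂ (proj₁ ∘ g , Bg)
  ram {V} {R} {B} R-sym B-sym x cl | inj₂ (e , inj , Be)
      with ramN {Σ V (B (x zero))} {λ u v → R (proj₁ u) (proj₁ v)} {λ u v → B (proj₁ u) (proj₁ v)}
             R-sym B-sym (λ i → x (suc (e i)) , Be i)
             (λ i j i≢j → cl _ _ (i≢j ∘ inj ∘ Finₚ.suc-injective))
  ...   | inj₁ (g , Rg) = inj₁ (proj₁ ∘ g , Rg)
  ...   | inj₂ (g , Bg) = inj₂ (x zero ◂ (proj₁ ∘ g) , ◂-clique {R = B} B-sym {g = proj₁ ∘ g} (proj₂ ∘ g) Bg)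

-- Finding an extremal colouring constructively requires deciding whether a colouring of given size
-- exists. Cliques and colourings are searched for as vectors and then transferred pointwise to
-- functions.
Omniscient : Set → Set₁
Omniscient A = {P : A → Set} → (∀ a → Dec (P a)) → Dec (Σ A P)

Bool-omniscient : Omniscient Bool
Bool-omniscient P? with P? true | P? false
... | yes p | _     = yes (true , p)
... | no _  | yes p = yes (false , p)
... | no ¬t | no ¬f = no λ { (true , p) → ¬t p ; (false , p) → ¬f p }

Vec-omniscient : ∀ {A} → Omniscient A → ∀ n → Omniscient (Vec A n)
Vec-omniscient om zero    P? = map′ ([] ,_) (λ { ([] , p) → p }) (P? [])
Vec-omniscient om (suc n) P? =
  map′ (λ { (x , xs , p) → (x ∷ xs) , p }) (λ { ((x ∷ xs) , p) → x , xs , p })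
       (om (λ x → Vec-omniscient om n (λ xs → P? (x ∷ xs))))

clique? : ∀ {q} {R : Fin q → Fin q → Set} → (∀ u v → Dec (R u v)) → ∀ k → Dec (Σ (Fin k → Fin q) (Clique R))
clique? {R = R} R? k =
  map′ (λ { (v , cl) → lookup v , cl })
       (λ { (g , cl) → tabulate g , λ i j i≢j →
              subst₂ R (sym (Vecₚ.lookup∘tabulate g i)) (sym (Vecₚ.lookup∘tabulate g j)) (cl i j i≢j) })
       (Vec-omniscient Finₚ.any? k λ v → Finₚ.all? λ i → Finₚ.all? λ j →
          ¬? (i Finₚ.≟ j) →-dec R? (lookup v i) (lookup v j))

record SymFun (V : Set) : Set where
  constructor mkSym
  field
    fn     : V → V → Bool
    fn-sym : ∀ u v → fn u v ≡ fn v u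
open SymFun

record Edge {V : Set} (A : V → V → Set) (c : V → V → Bool) (γ : Bool) (u v : V) : Set where
  constructor edge
  field
    adjacent : A u v
    coloured : c u v ≡ γ
open Edge

Edge-sym : ∀ {V} {A : V → V → Set} → Symmetric A → (c : SymFun V) → ∀ {γ} → Symmetric (Edge A (fn c) γ)
Edge-sym A-sym c (edge uv eq) = edge (A-sym uv) (trans (fn-sym c _ _) eq)

Pair : ∀ {V : Set} → (V → V → Bool) → Bool → V → V → Set
Pair = Edge _≢_

Pair-sym : ∀ {V} (c : SymFun V) {γ} → Symmetric (Pair (fn c) γ)
Pair-sym c = Edge-sym (λ u≢v → u≢v ∘ sym) c

NoClique : ∀ {V : Set} → (V → V → Set) → ℕ → Set
NoClique {V} R k = (g : Fin k → V) → ¬ Clique R g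

Avoids : ℕ → ℕ → ∀ q → (Fin q → Fin q → Bool) → Set
Avoids a b q c = NoClique (Pair c true) a × NoClique (Pair c false) b

AvoidingColouring : ℕ → ℕ → ℕ → Set
AvoidingColouring a b q = Σ (SymFun (Fin q)) λ c → Avoids a b q (fn c)

pair? : ∀ {q} (c : Fin q → Fin q → Bool) γ u v → Dec (Pair c γ u v)
pair? c γ u v = map′ (λ (u≢v , eq) → edge u≢v eq) (λ (edge u≢v eq) → u≢v , eq) (¬? (u Finₚ.≟ v) ×-dec (c u v Boolₚ.≟ γ))

avoids-resp : ∀ {a b q c c′} → (∀ u v → c u v ≡ c′ u v) → Avoids a b q c → Avoids a b q c′
avoids-resp {q = q} {c} {c′} c≗c′ (noR , noB) = (λ g cl → noR g (resp g cl)) , (λ g cl → noB g (resp g cl))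
  where
  resp : ∀ {k γ} (g : Fin k → Fin q) → Clique (Pair c′ γ) g → Clique (Pair c γ) g
  resp g cl i j i≢j = edge (adjacent (cl i j i≢j)) (trans (c≗c′ (g i) (g j)) (coloured (cl i j i≢j)))

avoidingColouring? : ∀ a b q → Dec (AvoidingColouring a b q)
avoidingColouring? a b q = map′ to from
  (Vec-omniscient (Vec-omniscient Bool-omniscient q) q {λ M → (∀ u v → entry M u v ≡ entry M v u) × Avoids a b q (entry M)}
    λ M → (Finₚ.all? λ u → Finₚ.all? λ v → entry M u v Boolₚ.≟ entry M v u) ×-dec
          (none (entry M) true a ×-dec none (entry M) false b))
  where
  entry : Vec (Vec Bool q) q → Fin q → Fin q → Bool
  entry M u v = lookup (lookup M u) v

  none : ∀ c γ k → Dec (NoClique (Pair c γ) k)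
  none c γ k = map′ (λ ¬cl g cl → ¬cl (g , cl)) (λ no (g , cl) → no g cl) (¬? (clique? (pair? c γ) k))

  to : _ → AvoidingColouring a b q
  to (M , M-sym , av) = mkSym (entry M) M-sym , av

  matrix : (Fin q → Fin q → Bool) → Vec (Vec Bool q) q
  matrix c = tabulate λ u → tabulate (c u)

  entry-matrix : ∀ c u v → c u v ≡ entry (matrix c) u v
  entry-matrix c u v = sym (trans (cong (λ r → lookup r v) (Vecₚ.lookup∘tabulate _ u)) (Vecₚ.lookup∘tabulate (c u) v))

  from : AvoidingColouring a b q → _
  from (c , av) = matrix (fn c) ,
    (λ u v → trans (sym (entry-matrix (fn c) u v)) (trans (fn-sym c u v) (entry-matrix (fn c) v u))) ,
    avoids-resp {a} {b} (entry-matrix (fn c)) av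

¬avoiding-large : ∀ a b → Σ ℕ λ N → ¬ AvoidingColouring a b N
¬avoiding-large a b with ramsey a b
... | N , ram = N , λ { (c , noR , noB) → [ (λ { (g , cl) → noR g cl }) , (λ { (g , cl) → noB g cl }) ]′
    (ram (Pair-sym c) (Pair-sym c) id (λ i j i≢j → bit {c = fn c} (fn c i j) i≢j refl)) }
  where
  bit : ∀ {V : Set} {c : V → V → Bool} {u v} x → u ≢ v → c u v ≡ x → Pair c true u v ⊎ Pair c false u v
  bit true  u≢v eq = inj₁ (edge u≢v eq)
  bit false u≢v eq = inj₂ (edge u≢v eq)

threshold : {P : ℕ → Set} → (∀ n → Dec (P n)) → P 0 → ∀ N → ¬ P N → Σ ℕ λ n → P n × ¬ P (suc n)
threshold P? p₀ zero    ¬p = contradiction p₀ ¬p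
threshold P? p₀ (suc N) ¬p with P? N
... | yes p = N , p , ¬p
... | no ¬q = threshold P? p₀ N ¬q

-- The search descends from a size excluded by Ramsey's theorem to the first size with a colouring;
-- size 0 has one, as the forbidden cliques are nonempty.
avoiding-maximal : ∀ a b → Σ ℕ λ q → AvoidingColouring (suc a) (suc b) q × ¬ AvoidingColouring (suc a) (suc b) (suc q)
avoiding-maximal a b with ¬avoiding-large (suc a) (suc b)
... | N , ¬av = threshold (avoidingColouring? _ _) (mkSym (λ ()) (λ ()) , (λ g _ → Finₚ.¬Fin0 (g zero)) , (λ g _ → Finₚ.¬Fin0 (g zero))) N ¬av

joined : Bool → ∀ {q} → SymFun (Fin q) → SymFun (Fin (suc q))
joined δ c = mkSym (λ { zero _ → δ ; (suc _) zero → δ ; (suc u) (suc v) → fn c u v })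
                   (λ { zero zero → refl ; zero (suc _) → refl ; (suc _) zero → refl ; (suc u) (suc v) → fn-sym c u v })

module _ {q} (c : SymFun (Fin q)) (δ : Bool) where

  private
    c⁺ = fn (joined δ c)

  joined-clique : ∀ {γ k} (g : Fin k → Fin (suc q)) → (∀ i → g i ≢ zero) → Clique (Pair c⁺ γ) g →
                  Σ (Fin k → Fin q) (Clique (Pair (fn c) γ))
  joined-clique {γ} {k} g g≢0 cl = g′ , cl′
    where
    lower : ∀ (u : Fin (suc q)) → u ≢ zero → Σ (Fin q) λ v → u ≡ suc v
    lower zero    u≢0 = contradiction refl u≢0
    lower (suc v) _   = v , refl
    g′ : Fin k → Fin q
    g′ i = proj₁ (lower (g i) (g≢0 i))
    cl′ : Clique (Pair (fn c) γ) g′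
    cl′ i j i≢j with lower (g i) (g≢0 i) | lower (g j) (g≢0 j) | cl i j i≢j
    ... | u , eu | v , ev | p with g i | g j
    ...   | _ | _ with refl ← eu with refl ← ev = edge (adjacent p ∘ cong suc) (coloured p)

  -- A clique loses at most one vertex when the new vertex is removed; if the new vertex is not in
  -- it, any vertex is dropped to reach size `k`.
  joined-same : ∀ {k} → NoClique (Pair (fn c) δ) k → NoClique (Pair c⁺ δ) (suc k)
  joined-same {k} none g cl with Finₚ.any? (λ i → g i Finₚ.≟ zero)
  ... | yes (p , gp≡0) with joined-clique (g ∘ punchIn p)
                              (λ i gi≡0 → adjacent (cl (punchIn p i) p (Finₚ.punchInᵢ≢i p i)) (trans gi≡0 (sym gp≡0)))
                              (clique-∘ {R = Pair c⁺ δ} (Finₚ.punchIn-injective p _ _) cl)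
  ...   | h , clh = none h clh
  joined-same none g cl | no ¬0 with joined-clique g (λ i eq → ¬0 (i , eq)) cl
  ...   | h , clh = none (h ∘ suc) (clique-∘ {R = Pair (fn c) δ} Finₚ.suc-injective clh)

  -- All edges at the new vertex have colour `δ`, so it lies in no clique of another colour with at
  -- least two vertices; `p′` is such a second vertex.
  joined-other : ∀ {γ k} → γ ≢ δ → NoClique (Pair (fn c) γ) (suc (suc k)) → NoClique (Pair c⁺ γ) (suc (suc k))
  joined-other {γ} γ≢δ none g cl with Finₚ.any? (λ i → g i Finₚ.≟ zero)
  ... | no ¬0 with joined-clique g (λ i eq → ¬0 (i , eq)) cl
  ...   | h , clh = none h clh
  joined-other {γ} γ≢δ none g cl | yes (p , gp≡0) = γ≢δ (trans (sym (coloured (cl p p′ (p≢ ∘ sym)))) (cong (λ u → c⁺ u (g p′)) gp≡0))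
    where
    p′ = punchIn p zero
    p≢ : p′ ≢ p
    p≢ = Finₚ.punchInᵢ≢i p zero

negate : ∀ {V} → SymFun V → SymFun V
negate c = mkSym (λ u v → not (fn c u v)) (λ u v → cong not (fn-sym c u v))

negate-clique : ∀ {V : Set} {c : V → V → Bool} {γ k} {g : Fin k → V} →
                Clique (Pair (λ u v → not (c u v)) γ) g → Clique (Pair c (not γ)) g
negate-clique cl i j i≢j = edge (adjacent (cl i j i≢j)) (trans (sym (Boolₚ.not-involutive _)) (cong not (coloured (cl i j i≢j))))

-- Here and below red is true, blue is false, and m is 3 + μ.
record Core (μ : ℕ) : Set where
  field
    size         : ℕ
    ψ            : SymFun (Fin size)
    red-free     : NoClique (Pair (fn ψ) true) (3 + μ)
    blue-free    : NoClique (Pair (fn ψ) false) (2 + μ)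
    unavoidable₁ : ∀ (c : SymFun (Fin size)) → ¬ (∀ γ → NoClique (Pair (fn c) γ) (2 + μ))
    unavoidable₂ : ∀ (c : SymFun (Fin size)) γ →
                   NoClique (Pair (fn c) γ) (1 + μ) → ¬ NoClique (Pair (fn c) (not γ)) (3 + μ)

-- Joining in red serves `unavoidable₁`. Joining in blue serves `unavoidable₂` for blue, since it
-- raises the bound on blue cliques from m - 2 to m - 1; for red the two colours are exchanged
-- first.
core : ∀ μ → Core μ
core μ = fromMaximal (avoiding-maximal (2 + μ) (1 + μ))
  where
  fromMaximal : Σ ℕ (λ q → AvoidingColouring (3 + μ) (2 + μ) q × ¬ AvoidingColouring (3 + μ) (2 + μ) (suc q)) → Core μ
  fromMaximal (q , (ψ , noR , noB) , maximal) = record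
    { size         = q
    ; ψ            = ψ
    ; red-free     = noR
    ; blue-free    = noB
    ; unavoidable₁ = λ c none →
        maximal (joined true c , joined-same c true (none true) , joined-other c true (λ ()) (none false))
    ; unavoidable₂ = unavoidable
    }
    where
    unavoidable : ∀ c γ → NoClique (Pair (fn c) γ) (1 + μ) → ¬ NoClique (Pair (fn c) (not γ)) (3 + μ)
    unavoidable c false small large =
      maximal (joined false c , joined-other c false (λ ()) large , joined-same c false small)
    unavoidable c true small large =
      maximal ( joined false (negate c)
              , joined-other (negate c) false (λ ()) (λ g cl → large g (negate-clique cl))
              , joined-same (negate c) false (λ g cl → small g (negate-clique cl)))

-- Vertex-Ramsey graphs

record Finite (V : Set) : Set where
  constructor enumerated
  field
    {card} : ℕ
    index  : V ↔ Fin card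

  toIndex : V → Fin card
  toIndex = Inverse.to index

  fromIndex : Fin card → V
  fromIndex = Inverse.from index

  fromIndex-toIndex : ∀ v → fromIndex (toIndex v) ≡ v
  fromIndex-toIndex v = Inverse.inverseʳ index refl

  toIndex-fromIndex : ∀ i → toIndex (fromIndex i) ≡ i
  toIndex-fromIndex i = Inverse.inverseˡ index refl

  infix 4 _≟_
  _≟_ : DecidableEquality V
  _≟_ = via-injection (↔⇒↣ index) Finₚ._≟_

  search : {P : V → Set} → (∀ v → Dec (P v)) → Dec (Σ V P)
  search {P} P? = map′ (λ (i , p) → fromIndex i , p)
                       (λ (v , p) → toIndex v , subst P (sym (fromIndex-toIndex v)) p)
                       (Finₚ.any? (P? ∘ fromIndex))

Fin-finite : ∀ {n} → Finite (Fin n)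
Fin-finite = enumerated ↔-refl

⊎-finite : ∀ {A B} → Finite A → Finite B → Finite (A ⊎ B)
⊎-finite (enumerated a) (enumerated b) = enumerated (↔-trans (a ⊎-↔ b) (↔-sym Finₚ.+↔⊎))

×-finite : ∀ {A B} → Finite A → Finite B → Finite (A × B)
×-finite (enumerated a) (enumerated b) = enumerated (↔-trans (a ×-↔ b) (↔-sym Finₚ.*↔×))

-- Vertices form any finite type, so that copies and unions are plain products and sums; only the
-- finished gadget is renumbered by `Fin`.
record ColGraph : Set₁ where
  field
    V      : Set
    finite : Finite V
    Adj    : V → V → Set
    adj?   : ∀ u v → Dec (Adj u v)
    adjSym : Symmetric Adj
    irrefl : ∀ {v} → ¬ Adj v v
    ψ      : SymFun V

  open Finite finite public

  EdgeOf : Bool → V → V → Set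
  EdgeOf = Edge Adj (fn ψ)

complete : ∀ {q} → SymFun (Fin q) → ColGraph
complete {q} c = record
  { V = Fin q ; finite = Fin-finite ; Adj = _≢_ ; adj? = λ u v → ¬? (u Finₚ.≟ v)
  ; adjSym = λ u≢v → u≢v ∘ sym ; irrefl = λ v≢v → v≢v refl ; ψ = c }

gather : ∀ {k} {P : Fin k → Set} {Q : Set} → (∀ i → P i ⊎ Q) → (∀ i → P i) ⊎ Q
gather {zero}  PQ = inj₁ λ ()
gather {suc k} PQ with PQ zero | gather (PQ ∘ suc)
... | inj₂ q | _       = inj₂ q
... | inj₁ _ | inj₂ q  = inj₂ q
... | inj₁ p | inj₁ ps = inj₁ λ { zero → p ; (suc i) → ps i }

module Folkman {μ} (𝒦 : Core μ) where

  open Core 𝒦 renaming (size to q; ψ to ψK)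

  K : ColGraph
  K = complete ψK

  open ColGraph

  Clean : ColGraph → Set
  Clean X = NoClique (EdgeOf X true) (3 + μ) × NoClique (EdgeOf X false) (2 + μ)

  MonoK : (X : ColGraph) → ∀ {c} → (V X → Fin c) → Set
  MonoK X f = Σ (Fin q → V X) λ h → Clique (Adj X) h × (∀ a b → f (h a) ≡ f (h b))

  -- An empty core would have no monochromatic clique of positive size, against `unavoidable₁`.
  core-vertex : Fin q
  core-vertex = nonempty q (unavoidable₁ ψK ∘ λ noFin γ g cl → noFin (g zero))
    where
    nonempty : ∀ n → ¬ ¬ Fin n → Fin n
    nonempty zero    ¬¬v = ⊥-elim (¬¬v λ ())
    nonempty (suc n) _   = zero

  -- Every colouring of D without a nonzero monochromatic K has a partial
  -- embedding b i of K all of whose first j vertices get colour zero.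
  record Stage (c j : ℕ) : Set₁ where
    field
      D     : ColGraph
      clean : Clean D
      label : V D → Fin q
      count : ℕ
      b     : Fin count → Fin q → V D
      b-hom : ∀ i {a a′} → toℕ a < j → toℕ a′ < j → a ≢ a′ →
              EdgeOf D (fn ψK a a′) (b i a) (b i a′)
      b-label : ∀ i {a} → toℕ a < j → label (b i a) ≡ a
      dichotomy : (f : V D → Fin (suc c)) →
                  (Σ (Fin count) λ i → ∀ a → toℕ a < j → f (b i a) ≡ zero) ⊎ MonoK D f

  initial : ∀ c → Stage c 0
  initial c = record
    { D = record
      { V = Fin 1 ; finite = Fin-finite ; Adj = λ _ _ → ⊥ ; adj? = λ _ _ → no λ ()
      ; adjSym = λ () ; irrefl = λ () ; ψ = mkSym (λ _ _ → true) (λ _ _ → refl) }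
    ; clean = (λ g cl → adjacent (cl zero (suc zero) λ ())) , (λ g cl → adjacent (cl zero (suc zero) λ ()))
    ; label = λ _ → core-vertex
    ; count = 1
    ; b = λ _ _ → zero
    ; b-hom = λ _ ()
    ; b-label = λ _ ()
    ; dichotomy = λ f → inj₁ (zero , λ _ ())
    }

  module Extend {c j} (S : Stage c j) (ĵ : Fin q) (ĵ≡j : toℕ ĵ ≡ j)
                (C : ColGraph) (C-clean : Clean C)
                (C-mono : (f : V C → Fin c) → MonoK C f) where

    open Stage S

    -- A word picks a vertex in each of the copies of C, one copy for every
    -- partial embedding b i; D⁺ has one copy of D per word τ, in which the i-th
    -- letter of τ extends b i by the vertex ĵ.
    Word : Set
    Word = Fin (card C ^ count)

    letter : Word → Fin count → V C
    letter τ i = fromIndex C (finToFun τ i)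

    Vertex : Set
    Vertex = (Fin count × V C) ⊎ (Word × V D)

    Attached : Fin count → V C → Word → V D → Set
    Attached i x τ d = letter τ i ≡ x × Σ (Fin q) λ a → toℕ a < j × b i a ≡ d

    _∼_ : Vertex → Vertex → Set
    inj₁ (i , x) ∼ inj₁ (i′ , x′) = i ≡ i′ × Adj C x x′
    inj₁ (i , x) ∼ inj₂ (τ , d)   = Attached i x τ d
    inj₂ (τ , d) ∼ inj₁ (i , x)   = Attached i x τ d
    inj₂ (τ , d) ∼ inj₂ (τ′ , d′) = τ ≡ τ′ × Adj D d d′

    attached? : ∀ i x τ d → Dec (Attached i x τ d)
    attached? i x τ d = _≟_ C (letter τ i) x ×-dec Finₚ.any? λ a → (toℕ a ℕₚ.<? j) ×-dec _≟_ D (b i a) d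

    _∼?_ : ∀ u v → Dec (u ∼ v)
    inj₁ (i , x) ∼? inj₁ (i′ , x′) = (i Finₚ.≟ i′) ×-dec adj? C x x′
    inj₁ (i , x) ∼? inj₂ (τ , d)   = attached? i x τ d
    inj₂ (τ , d) ∼? inj₁ (i , x)   = attached? i x τ d
    inj₂ (τ , d) ∼? inj₂ (τ′ , d′) = (τ Finₚ.≟ τ′) ×-dec adj? D d d′

    ∼-sym : ∀ u v → u ∼ v → v ∼ u
    ∼-sym (inj₁ _) (inj₁ _) (refl , xx′) = refl , adjSym C xx′
    ∼-sym (inj₁ _) (inj₂ _) at           = at
    ∼-sym (inj₂ _) (inj₁ _) at           = at
    ∼-sym (inj₂ _) (inj₂ _) (refl , dd′) = refl , adjSym D dd′

    ∼-irrefl : ∀ u → ¬ u ∼ u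
    ∼-irrefl (inj₁ _) (_ , xx) = irrefl C xx
    ∼-irrefl (inj₂ _) (_ , dd) = irrefl D dd

    -- Edges between the halves copy the colours of `K`, with every vertex of a copy of `C` standing
    -- for `ĵ` and a vertex of `D` for its label. Hence an extended partial embedding still
    -- preserves colours.
    colour : Vertex → Vertex → Bool
    colour (inj₁ (_ , x)) (inj₁ (_ , x′)) = fn (ψ C) x x′
    colour (inj₁ _)       (inj₂ (_ , d))  = fn ψK ĵ (label d)
    colour (inj₂ (_ , d)) (inj₁ _)        = fn ψK (label d) ĵ
    colour (inj₂ (_ , d)) (inj₂ (_ , d′)) = fn (ψ D) d d′

    colour-sym : ∀ u v → colour u v ≡ colour v u
    colour-sym (inj₁ _) (inj₁ _) = fn-sym (ψ C) _ _
    colour-sym (inj₁ _) (inj₂ _) = fn-sym ψK _ _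
    colour-sym (inj₂ _) (inj₁ _) = fn-sym ψK _ _
    colour-sym (inj₂ _) (inj₂ _) = fn-sym (ψ D) _ _

    D⁺ : ColGraph
    D⁺ = record
      { V = Vertex
      ; finite = ⊎-finite (×-finite Fin-finite (finite C)) (×-finite Fin-finite (finite D))
      ; Adj = _∼_ ; adj? = _∼?_ ; adjSym = λ {u} {v} → ∼-sym u v ; irrefl = λ {u} → ∼-irrefl u
      ; ψ = mkSym colour colour-sym }

    below-ĵ : ∀ {a} → toℕ a < j → a ≢ ĵ
    below-ĵ a<j refl = ℕₚ.<-irrefl ĵ≡j a<j

    -- A clique of D⁺ projects to one of C, of D, or (if it meets both halves) of K.
    module _ {γ k} (g : Fin k → Vertex) (cl : Clique (EdgeOf D⁺ γ) g) where

      IsLeft IsRight : Fin k → Set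
      IsLeft  p = Σ (Fin count × V C) λ ix → g p ≡ inj₁ ix
      IsRight p = Σ (Word × V D) λ τd → g p ≡ inj₂ τd

      left-or-right : ∀ p → IsLeft p ⊎ IsRight p
      left-or-right p with g p
      ... | inj₁ ix = inj₁ (ix , refl)
      ... | inj₂ τd = inj₂ (τd , refl)

      edge-at : ∀ {u v} p p′ → p ≢ p′ → g p ≡ u → g p′ ≡ v → EdgeOf D⁺ γ u v
      edge-at p p′ p≢p′ refl refl = cl p p′ p≢p′

      clique-C : (∀ p → IsLeft p) → Σ (Fin k → V C) (Clique (EdgeOf C γ))
      clique-C all = (λ p → proj₂ (proj₁ (all p))) , λ p p′ p≢p′ →
        let e = edge-at p p′ p≢p′ (proj₂ (all p)) (proj₂ (all p′)) in edge (proj₂ (adjacent e)) (coloured e)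

      clique-D : (∀ p → IsRight p) → Σ (Fin k → V D) (Clique (EdgeOf D γ))
      clique-D all = (λ p → proj₂ (proj₁ (all p))) , λ p p′ p≢p′ →
        let e = edge-at p p′ p≢p′ (proj₂ (all p)) (proj₂ (all p′)) in edge (proj₂ (adjacent e)) (coloured e)

      -- Adjacent left vertices share the index `i`, and a right vertex sees only the letter of its
      -- own word there, so the clique has a single left vertex, sent to `ĵ`. Its right vertices all
      -- lie in the image of `b i` below `j`, and are sent to their labels.
      clique-K : ∀ {l r} → IsLeft l → IsRight r → Σ (Fin k → Fin q) (Clique (EdgeOf K γ))
      clique-K {l} {r} ((i , x) , gl) ((τ , d) , gr) = (λ p → class (left-or-right p)) , λ p p′ p≢p′ → pair p≢p′ (left-or-right p) (left-or-right p′)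
        where
        l≢ : ∀ {p} → IsRight p → l ≢ p
        l≢ (_ , gp) refl with trans (sym gl) gp
        ... | ()
        r≢ : ∀ {p} → IsLeft p → r ≢ p
        r≢ (_ , gp) refl with trans (sym gr) gp
        ... | ()

        att : ∀ {p} (R : IsRight p) → Attached i x (proj₁ (proj₁ R)) (proj₂ (proj₁ R))
        att {p} R = adjacent (edge-at l p (l≢ R) gl (proj₂ R))

        class : ∀ {p} → IsLeft p ⊎ IsRight p → Fin q
        class (inj₁ _) = ĵ
        class (inj₂ R) = proj₁ (proj₂ (att R))

        label-class : ∀ {p} (R : IsRight p) → label (proj₂ (proj₁ R)) ≡ class (inj₂ R)
        label-class R with att R
        ... | _ , a , a<j , refl = b-label i a<j

        class<j : ∀ {p} (R : IsRight p) → toℕ (class (inj₂ R)) < j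
        class<j R = proj₁ (proj₂ (proj₂ (att R)))

        pair : ∀ {p p′} → p ≢ p′ → (s : IsLeft p ⊎ IsRight p) (s′ : IsLeft p′ ⊎ IsRight p′) →
               EdgeOf K γ (class s) (class s′)
        pair {p} {p′} p≢p′ (inj₁ L@((i₁ , x₁) , gp)) (inj₁ L′@((i₂ , x₂) , gp′))
          with adjacent (edge-at p p′ p≢p′ gp gp′) | adjacent (edge-at r p (r≢ L) gr gp) | adjacent (edge-at r p′ (r≢ L′) gr gp′)
        ... | refl , xx | refl , _ | refl , _ = contradiction xx (irrefl C)
        pair {p} {p′} p≢p′ (inj₁ (_ , gp)) (inj₂ R@(_ , gp′)) =
          edge (below-ĵ (class<j R) ∘ sym)
               (trans (cong (fn ψK ĵ) (sym (label-class R))) (coloured (edge-at p p′ p≢p′ gp gp′)))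
        pair {p} {p′} p≢p′ (inj₂ R@(_ , gp)) (inj₁ (_ , gp′)) =
          edge (below-ĵ (class<j R))
               (trans (cong (λ a → fn ψK a ĵ) (sym (label-class R))) (coloured (edge-at p p′ p≢p′ gp gp′)))
        pair {p} {p′} p≢p′ (inj₂ R@((τ₁ , d₁) , gp)) (inj₂ R′@((τ₂ , d₂) , gp′))
          with att R | att R′ | edge-at p p′ p≢p′ gp gp′
        ... | _ , a , a<j , refl | _ , a′ , a′<j , refl | e = edge a≢a′ (trans (sym (coloured (b-hom i a<j a′<j a≢a′))) (coloured e))
          where
          a≢a′ : a ≢ a′
          a≢a′ refl = irrefl D (proj₂ (adjacent e))

    noClique : ∀ {γ k} → NoClique (EdgeOf C γ) k → NoClique (EdgeOf D γ) k → NoClique (EdgeOf K γ) k →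
               NoClique (EdgeOf D⁺ γ) k
    noClique {γ} {k} noC noD noK g cl with gather {P = IsRight g cl} {Q = Σ (Fin k) (IsLeft g cl)}
                                           (λ p → [ (λ L → inj₂ (p , L)) , inj₁ ]′ (left-or-right g cl p))
    ... | inj₁ allR = let h , clh = clique-D g cl allR in noD h clh
    ... | inj₂ (l , L) with gather {P = IsLeft g cl} {Q = Σ (Fin k) (IsRight g cl)}
                                           (λ p → [ inj₁ , (λ R → inj₂ (p , R)) ]′ (left-or-right g cl p))
    ...   | inj₁ allL    = let h , clh = clique-C g cl allL in noC h clh
    ...   | inj₂ (r , R) = let h , clh = clique-K g cl L R in noK h clh

    count⁺ : ℕ
    count⁺ = card C ^ count * count

    b⁺ : Word × Fin count → Fin q → Vertex
    b⁺ (τ , i) a with a Finₚ.≟ ĵ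
    ... | yes _ = inj₁ (i , letter τ i)
    ... | no _  = inj₂ (τ , b i a)

    label⁺ : Vertex → Fin q
    label⁺ (inj₁ _)       = ĵ
    label⁺ (inj₂ (_ , d)) = label d

    <suc : ∀ {a} → toℕ a < suc j → a ≢ ĵ → toℕ a < j
    <suc {a} (s≤s a≤j) a≢ĵ = ℕₚ.≤∧≢⇒< a≤j λ a≡j → a≢ĵ (Finₚ.toℕ-injective (trans a≡j (sym ĵ≡j)))

    b⁺-hom : ∀ w {a a′} → toℕ a < suc j → toℕ a′ < suc j → a ≢ a′ →
             EdgeOf D⁺ (fn ψK a a′) (b⁺ w a) (b⁺ w a′)
    b⁺-hom (τ , i) {a} {a′} a< a′< a≢a′ with a Finₚ.≟ ĵ | a′ Finₚ.≟ ĵ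
    ... | yes refl | yes refl = contradiction refl a≢a′
    ... | yes refl | no a′≢ĵ  = edge (refl , a′ , <suc a′< a′≢ĵ , refl) (cong (fn ψK ĵ) (b-label i (<suc a′< a′≢ĵ)))
    ... | no a≢ĵ   | yes refl = edge (refl , a , <suc a< a≢ĵ , refl) (cong (λ a → fn ψK a ĵ) (b-label i (<suc a< a≢ĵ)))
    ... | no a≢ĵ   | no a′≢ĵ  with b-hom i (<suc a< a≢ĵ) (<suc a′< a′≢ĵ) a≢a′
    ...   | e = edge (refl , adjacent e) (coloured e)

    b⁺-label : ∀ w {a} → toℕ a < suc j → label⁺ (b⁺ w a) ≡ a
    b⁺-label (τ , i) {a} a< with a Finₚ.≟ ĵ
    ... | yes refl = refl
    ... | no a≢ĵ   = b-label i (<suc a< a≢ĵ)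

    -- If some copy of `C` has no vertex of colour zero, only `c` colours remain there and `C-mono`
    -- applies. Otherwise a zero vertex from each copy spells a word `τ`; in the copy of `D` at `τ`,
    -- a zero partial embedding `b i` is extended by the zero letter at `i`.
    dichotomy⁺ : (f : Vertex → Fin (suc c)) →
                 (Σ (Word × Fin count) λ w → ∀ a → toℕ a < suc j → f (b⁺ w a) ≡ zero) ⊎ MonoK D⁺ f
    dichotomy⁺ f with gather {P = λ i → Σ (V C) λ x → f (inj₁ (i , x)) ≡ zero} zeroOrMono
      where
      zeroOrMono : ∀ i → (Σ (V C) λ x → f (inj₁ (i , x)) ≡ zero) ⊎ MonoK D⁺ f
      zeroOrMono i with search C (λ x → f (inj₁ (i , x)) Finₚ.≟ zero)
      ... | yes p = inj₁ p
      ... | no ¬0 with C-mono (λ x → punchOut {i = zero} (λ 0≡ → ¬0 (x , sym 0≡)))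
      ...   | h , clh , const = inj₂ ((λ a → inj₁ (i , h a)) , (λ a a′ a≢a′ → refl , clh a a′ a≢a′) ,
                                  λ a a′ → Finₚ.punchOut-injective {i = zero} _ _ (const a a′))
    ... | inj₂ mono = inj₂ mono
    ... | inj₁ pick with dichotomy (λ d → f (inj₂ (τ , d)))
      where
      τ : Word
      τ = funToFin (toIndex C ∘ proj₁ ∘ pick)
    ...   | inj₂ (h , clh , const) = inj₂ ((λ a → inj₂ (_ , h a)) , (λ a a′ a≢a′ → refl , clh a a′ a≢a′) , const)
    ...   | inj₁ (i , zeros) = inj₁ ((τ , i) , zeros⁺)
      where
      τ : Word
      τ = funToFin (toIndex C ∘ proj₁ ∘ pick)
      letter-τ : letter τ i ≡ proj₁ (pick i)
      letter-τ = trans (cong (fromIndex C) (Finₚ.finToFun-funToFin (toIndex C ∘ proj₁ ∘ pick) i))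
                       (fromIndex-toIndex C _)
      zeros⁺ : ∀ a → toℕ a < suc j → f (b⁺ (τ , i) a) ≡ zero
      zeros⁺ a a< with a Finₚ.≟ ĵ
      ... | yes refl = trans (cong (λ x → f (inj₁ (i , x))) letter-τ) (proj₂ (pick i))
      ... | no a≢ĵ   = zeros a (<suc a< a≢ĵ)

    decode : Fin count⁺ → Word × Fin count
    decode = remQuot count

    next : Stage c (suc j)
    next = record
      { D = D⁺
      ; clean = noClique (proj₁ C-clean) (proj₁ clean) red-free , noClique (proj₂ C-clean) (proj₂ clean) blue-free
      ; label = label⁺
      ; count = count⁺
      ; b = b⁺ ∘ decode
      ; b-hom = λ i → b⁺-hom (decode i)
      ; b-label = λ i → b⁺-label (decode i)
      ; dichotomy = λ f → [ (λ ((τ , i) , zeros) → inj₁ (combine τ i ,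
            λ a a< → subst (λ w → f (b⁺ w a) ≡ zero) (sym (Finₚ.remQuot-combine τ i)) (zeros a a<)))
          , inj₂ ]′ (dichotomy⁺ f)
      }

  record Arrowing (c : ℕ) : Set₁ where
    field
      X     : ColGraph
      clean : Clean X
      mono  : (f : V X → Fin c) → MonoK X f

  -- Induction on the number of colours. The graph for `c` colours plays the role of `C` in `q`
  -- successive extensions, after which a zero partial embedding is a whole copy of `K`. With no
  -- colours at all, the nonempty `K` has no colouring.
  arrowing : ∀ c → Arrowing c
  arrowing zero    = record
    { X = K ; clean = red-free , blue-free
    ; mono = λ f → id , (λ _ _ a≢b → a≢b) , λ a _ → contradiction (f a) λ () }
  arrowing (suc c) = record
    { X = Stage.D final ; clean = Stage.clean final ; mono = mono′ }
    where
    open Arrowing (arrowing c)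
    stage : ∀ j → j ≤ q → Stage c j
    stage zero    _   = initial c
    stage (suc j) j<q = Extend.next (stage j (ℕₚ.<⇒≤ j<q)) (fromℕ< j<q) (Finₚ.toℕ-fromℕ< j<q) X clean mono
    final : Stage c q
    final = stage q ℕₚ.≤-refl
    mono′ : (f : V (Stage.D final) → Fin (suc c)) → MonoK (Stage.D final) f
    mono′ f with Stage.dichotomy final f
    ... | inj₂ m = m
    ... | inj₁ (i , zeros) = Stage.b final i ,
          (λ a a′ a≢a′ → adjacent (Stage.b-hom final i (Finₚ.toℕ<n a) (Finₚ.toℕ<n a′) a≢a′)) ,
          (λ a a′ → trans (zeros a (Finₚ.toℕ<n a)) (sym (zeros a′ (Finₚ.toℕ<n a′))))

-- Clones and twins

module _ {A : Set} (A-finite : Finite A) where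

  open Finite A-finite

  private
    bit : Bool → Fin 2
    bit = Inverse.from Finₚ.2↔Bool

    bit-injective : ∀ {x y} → bit x ≡ bit y → x ≡ y
    bit-injective {x} {y} eq = trans (sym (Inverse.inverseˡ Finₚ.2↔Bool refl))
                                     (trans (cong (Inverse.to Finₚ.2↔Bool) eq) (Inverse.inverseˡ Finₚ.2↔Bool refl))

  -- Packs a family of two-valued colours into one of finitely many colours, as pigeonholing and the
  -- arrowing property require.
  encode : (A → Bool) → Fin (2 ^ card)
  encode f = funToFin (bit ∘ f ∘ fromIndex)

  encode-injective : ∀ {f g} → encode f ≡ encode g → ∀ a → f a ≡ g a
  encode-injective {f} {g} eq a = trans (cong f (sym (fromIndex-toIndex a))) (trans (bit-injective
    (trans (sym (Finₚ.finToFun-funToFin (bit ∘ f ∘ fromIndex) (toIndex a)))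
    (trans (cong (λ k → finToFun k (toIndex a)) eq) (Finₚ.finToFun-funToFin (bit ∘ g ∘ fromIndex) (toIndex a)))))
    (cong g (fromIndex-toIndex a)))

  elements : List A
  elements = mapᴸ fromIndex (allFin card)

  ∈-elements : ∀ a → a ∈ elements
  ∈-elements a = subst (_∈ elements) (fromIndex-toIndex a) (∈-map⁺ fromIndex (∈-allFin (toIndex a)))

-- A second vertex over `x` that neither `p` nor the colours `φ` from the rest of the section `h`
-- can distinguish from `h x`.
record Twin {V V̂ C : Set} (ρ : V̂ → V) (φ : V̂ → V̂ → Bool) (p : V̂ → C) (h : V → V̂) (x : V) : Set where
  field
    twin    : V̂
    over    : ρ twin ≡ x
    other   : twin ≢ h x
    same-p  : p twin ≡ p (h x)
    same-φ  : ∀ y → y ≢ x → φ (h y) twin ≡ φ (h y) (h x)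

-- The blow-up has vertex set `V̂` and adjacency pulled back along `ρ`. The list `xs` holds the
-- vertices that are to have twins, so that they can be treated one by one.
record Cloning (V : Set) (r : ℕ) (xs : List V) : Set₁ where
  field
    V̂        : Set
    V̂-finite : Finite V̂
    ρ        : V̂ → V
    twins    : (φ : V̂ → V̂ → Bool) (p : V̂ → Fin r) → Σ (V → V̂) λ h →
               (∀ v → ρ (h v) ≡ v) × (∀ {x} → x ∈ xs → Twin ρ φ p h x)

module AddClones {V : Set} (fin : Finite V) (r : ℕ) (x : V) (xs : List V) where

  open Finite fin

  -- One more than the number of patterns of a clone: its value under `p`, and its colours towards
  -- the representatives of all vertices of `V`.
  clones : ℕ
  clones = suc (r * 2 ^ card)

  V₁ : Set
  V₁ = V ⊎ Fin clones

  ρ₁ : V₁ → V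
  ρ₁ = [ id , (λ _ → x) ]′

  module _ (𝒞 : Cloning V₁ r (mapᴸ inj₁ xs)) where

    private
      module C = Cloning 𝒞

    -- The inner section represents every clone of `x`; two clones with the same pattern become the
    -- representative of `x` and its twin. Twins of other vertices survive, since they agree as seen
    -- from all of `V₁`, in particular from the clone now representing `x`.
    twins : (φ : C.V̂ → C.V̂ → Bool) (p : C.V̂ → Fin r) → Σ (V → C.V̂) λ h →
            (∀ v → ρ₁ (C.ρ (h v)) ≡ v) × (∀ {y} → y ∈ (x ∷ xs) → Twin (ρ₁ ∘ C.ρ) φ p h y)
    twins φ p with C.twins φ p
    ... | h₁ , section₁ , twin₁ = h , section , twin
      where
      row : Fin clones → V → Bool
      row s y = φ (h₁ (inj₁ y)) (h₁ (inj₂ s))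

      pattern-of : Fin clones → Fin (r * 2 ^ card)
      pattern-of s = combine (p (h₁ (inj₂ s))) (encode fin (row s))

      collision = Finₚ.pigeonhole (ℕₚ.n<1+n _) pattern-of
      s s′ : Fin clones
      s  = proj₁ collision
      s′ = proj₁ (proj₂ collision)

      s≢s′ : s ≢ s′
      s≢s′ eq = Finₚ.<⇒≢ (proj₁ (proj₂ (proj₂ collision))) eq

      same : p (h₁ (inj₂ s)) ≡ p (h₁ (inj₂ s′)) × encode fin (row s) ≡ encode fin (row s′)
      same = Finₚ.combine-injective _ _ _ _ (proj₂ (proj₂ (proj₂ collision)))

      h₁-injective : ∀ {u v} → h₁ u ≡ h₁ v → u ≡ v
      h₁-injective {u} {v} eq = trans (sym (section₁ u)) (trans (cong C.ρ eq) (section₁ v))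

      choose : V → V₁
      choose y with y ≟ x
      ... | yes _ = inj₂ s
      ... | no _  = inj₁ y

      choose-x : choose x ≡ inj₂ s
      choose-x with x ≟ x
      ... | yes _  = refl
      ... | no x≢x = contradiction refl x≢x

      choose-≢ : ∀ {y} → y ≢ x → choose y ≡ inj₁ y
      choose-≢ {y} y≢x with y ≟ x
      ... | yes y≡x = contradiction y≡x y≢x
      ... | no _    = refl

      ρ-choose : ∀ y → ρ₁ (choose y) ≡ y
      ρ-choose y with y ≟ x
      ... | yes refl = refl
      ... | no _     = refl

      h : V → C.V̂
      h = h₁ ∘ choose

      section : ∀ v → ρ₁ (C.ρ (h v)) ≡ v
      section v = trans (cong ρ₁ (section₁ (choose v))) (ρ-choose v)

      twin-x : Twin (ρ₁ ∘ C.ρ) φ p h x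
      twin-x = record
        { twin   = h₁ (inj₂ s′)
        ; over   = cong ρ₁ (section₁ (inj₂ s′))
        ; other  = λ eq → s≢s′ (inj₂-injective (trans (sym choose-x) (sym (h₁-injective eq))))
        ; same-p = trans (sym (proj₁ same)) (cong (p ∘ h₁) (sym choose-x))
        ; same-φ = λ y y≢x → trans (cong (λ u → φ (h₁ u) (h₁ (inj₂ s′))) (choose-≢ y≢x))
                     (trans (sym (encode-injective fin (proj₂ same) y))
                     (sym (trans (cong (λ u → φ (h₁ u) (h x)) (choose-≢ y≢x))
                                 (cong (λ u → φ (h₁ (inj₁ y)) (h₁ u)) choose-x))))
        }

      twin : ∀ {y} → y ∈ (x ∷ xs) → Twin (ρ₁ ∘ C.ρ) φ p h y
      twin (here refl) = twin-x
      twin {y} (there y∈xs) with y ≟ x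
      ... | yes refl = twin-x
      ... | no y≢x   = record
        { twin   = T.twin
        ; over   = cong ρ₁ T.over
        ; other  = λ eq → T.other (trans eq hy)
        ; same-p = trans T.same-p (cong p (sym hy))
        ; same-φ = λ y′ y′≢y → trans (T.same-φ (choose y′) (choose≢ y′ y′≢y)) (cong (φ (h y′)) (sym hy))
        }
        where
        module T = Twin (twin₁ (∈-map⁺ inj₁ y∈xs))
        hy : h y ≡ h₁ (inj₁ y)
        hy = cong h₁ (choose-≢ y≢x)
        choose≢ : ∀ y′ → y′ ≢ y → choose y′ ≢ inj₁ y
        choose≢ y′ y′≢y eq = y′≢y (trans (sym (ρ-choose y′)) (cong ρ₁ eq))

    extended : Cloning V r (x ∷ xs)
    extended = record { V̂ = C.V̂ ; V̂-finite = C.V̂-finite ; ρ = ρ₁ ∘ C.ρ ; twins = twins }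

-- The map `f` keeps the list fixed during the induction while the vertex set grows from `V` to
-- `V₁`.
cloning : ∀ {W V : Set} → Finite V → ∀ r (f : W → V) ws → Cloning V r (mapᴸ f ws)
cloning fin r f []       = record
  { V̂ = _ ; V̂-finite = fin ; ρ = id ; twins = λ φ p → id , (λ _ → refl) , λ () }
cloning {W} fin r f (w ∷ ws) =
  extended (subst (Cloning V₁ r) (map-∘ ws) (cloning (⊎-finite fin Fin-finite) r f₁ ws))
  where
  open AddClones fin r (f w) (mapᴸ f ws)
  f₁ : W → V₁
  f₁ = inj₁ ∘ f

-- Linking two edges

-- What the argument needs to know of H: it contains a K_m, and it embeds into a
-- K_m whose last vertex has a twin.
record Target {N : ℕ} (_⌢_ : Fin N → Fin N → Set) (μ : ℕ) : Set₁ where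
  field
    corner        : Fin (3 + μ) → Fin N
    corner-clique : Clique _⌢_ corner
    two-corners   : ∀ v → (Σ (Fin (3 + μ)) λ p → v ≡ corner p) ⊎
                    (Σ (Fin (3 + μ)) λ p → Σ (Fin (3 + μ)) λ p′ → p ≢ p′ × v ⌢ corner p × v ⌢ corner p′)
    hub           : Fin N
    hub-adjacent  : ∀ v → v ≡ hub ⊎ hub ⌢ v
    fits          : ∀ {V : Set} {E : V → V → Set} → Symmetric E → (∀ {v} → ¬ E v v) →
                    (g : Fin (3 + μ) → V) → Clique E g →
                    ∀ z → z ≢ g (fromℕ (2 + μ)) → (∀ p → p ≢ fromℕ (2 + μ) → E (g p) z) →
                    Σ (Fin N → V) λ emb → (∀ {u v} → emb u ≡ emb v → u ≡ v) × (∀ u v → u ⌢ v → E (emb u) (emb v))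

Bool-finite : Finite Bool
Bool-finite = enumerated (↔-sym Finₚ.2↔Bool)

-- Translates between the colours of `B` and those of the host: the red of `B`, which has the weaker
-- clique bound, becomes `χ`, and its blue becomes the colour of the cross edges.
tint : Bool → Bool → Bool
tint χ true  = χ
tint χ false = not χ

tint-involutive : ∀ χ b → tint χ (tint χ b) ≡ b
tint-involutive true  true  = refl
tint-involutive true  false = refl
tint-involutive false true  = refl
tint-involutive false false = refl

tint-not : ∀ χ → tint χ (not χ) ≡ false
tint-not true  = refl
tint-not false = refl

not≢ : ∀ {b} → not b ≢ b
not≢ {true}  ()
not≢ {false} ()

module Gadgets {N : ℕ} {_⌢_ : Fin N → Fin N → Set} {μ : ℕ} (𝒯 : Target _⌢_ μ) (𝒦 : Core μ)
               (ends : Finite (Bool × Bool)) (𝒜 : Folkman.Arrowing 𝒦 (2 ^ Finite.card ends))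
               (𝒞 : Cloning (ColGraph.V (Folkman.Arrowing.X 𝒜)) (2 ^ Finite.card ends)
                            (mapᴸ id (elements (ColGraph.finite (Folkman.Arrowing.X 𝒜))))) where

  open Target 𝒯
  open ColGraph

  record Mono (X : ColGraph) (φ : SymFun (V X)) : Set where
    field
      γ        : Bool
      emb      : Fin N → V X
      emb-inj  : ∀ {u v} → emb u ≡ emb v → u ≡ v
      emb-edge : ∀ u v → u ⌢ v → Edge (Adj X) (fn φ) γ (emb u) (emb v)

  -- κ s false and κ s true are the two ends of the edge number s.
  record Link (X : ColGraph) : Set where
    field
      κ             : Bool → Bool → V X
      ends-adjacent : ∀ s → Adj X (κ s false) (κ s true)
      apart         : ∀ i j → ¬ Adj X (κ false i) (κ true j)
      same-ψ        : fn (ψ X) (κ false false) (κ false true) ≡ fn (ψ X) (κ true false) (κ true true)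

  Linked : ∀ {X} → Link X → SymFun (V X) → Set
  Linked ℓ φ = fn φ (κ false false) (κ false true) ≡ fn φ (κ true false) (κ true true)
    where open Link ℓ

  private
    open Core 𝒦 using (unavoidable₁; unavoidable₂) renaming (size to q)
    open Folkman 𝒦 using (core-vertex)
    open Folkman.Arrowing 𝒜 using () renaming (X to B; clean to B-clean; mono to B-mono)
    open Cloning 𝒞

    all∈ : ∀ x → x ∈ mapᴸ id (elements (finite B))
    all∈ x = subst (x ∈_) (sym (map-id _)) (∈-elements (finite B) x)

  module Attach (X : ColGraph) (X-free : ¬ Mono X (ψ X)) (ℓ : Link X) where

    open Link ℓ

    χ : Bool
    χ = fn (ψ X) (κ false false) (κ false true)

    Vertex : Set
    Vertex = V X ⊎ V̂

    Attached : V X → Set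
    Attached v = Σ Bool λ s → Σ Bool λ i → κ s i ≡ v

    _∼_ : Vertex → Vertex → Set
    inj₁ u ∼ inj₁ v = Adj X u v
    inj₁ u ∼ inj₂ _ = Attached u
    inj₂ _ ∼ inj₁ v = Attached v
    inj₂ x ∼ inj₂ y = Adj B (ρ x) (ρ y)

    attached? : ∀ v → Dec (Attached v)
    attached? v = Bool-omniscient λ s → Bool-omniscient λ i → _≟_ X (κ s i) v

    _∼?_ : ∀ u v → Dec (u ∼ v)
    inj₁ u ∼? inj₁ v = adj? X u v
    inj₁ u ∼? inj₂ _ = attached? u
    inj₂ _ ∼? inj₁ v = attached? v
    inj₂ x ∼? inj₂ y = adj? B (ρ x) (ρ y)

    ∼-sym : ∀ u v → u ∼ v → v ∼ u
    ∼-sym (inj₁ _) (inj₁ _) = adjSym X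
    ∼-sym (inj₁ _) (inj₂ _) = id
    ∼-sym (inj₂ _) (inj₁ _) = id
    ∼-sym (inj₂ _) (inj₂ _) = adjSym B

    ∼-irrefl : ∀ u → ¬ u ∼ u
    ∼-irrefl (inj₁ _) = irrefl X
    ∼-irrefl (inj₂ _) = irrefl B

    colour : Vertex → Vertex → Bool
    colour (inj₁ u) (inj₁ v) = fn (ψ X) u v
    colour (inj₁ _) (inj₂ _) = not χ
    colour (inj₂ _) (inj₁ _) = not χ
    colour (inj₂ x) (inj₂ y) = tint χ (fn (ψ B) (ρ x) (ρ y))

    colour-sym : ∀ u v → colour u v ≡ colour v u
    colour-sym (inj₁ _) (inj₁ _) = fn-sym (ψ X) _ _
    colour-sym (inj₁ _) (inj₂ _) = refl
    colour-sym (inj₂ _) (inj₁ _) = refl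
    colour-sym (inj₂ _) (inj₂ _) = cong (tint χ) (fn-sym (ψ B) _ _)

    X⁺ : ColGraph
    X⁺ = record
      { V = Vertex ; finite = ⊎-finite (finite X) V̂-finite
      ; Adj = _∼_ ; adj? = _∼?_ ; adjSym = λ {u} {v} → ∼-sym u v ; irrefl = λ {u} → ∼-irrefl u
      ; ψ = mkSym colour colour-sym }

    IsLeft IsRight : Vertex → Set
    IsLeft  u = Σ (V X) λ v → u ≡ inj₁ v
    IsRight u = Σ V̂ λ x → u ≡ inj₂ x

    left-or-right : ∀ u → IsLeft u ⊎ IsRight u
    left-or-right (inj₁ v) = inj₁ (v , refl)
    left-or-right (inj₂ x) = inj₂ (x , refl)

    -- By `apart`, the four ends span only the two linked edges, and `same-ψ` gives both the colour
    -- `χ`.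
    attached-pair : ∀ {u v} → Attached u → Attached v → Adj X u v → fn (ψ X) u v ≡ χ
    attached-pair (false , false , refl) (false , true  , refl) _  = refl
    attached-pair (false , true  , refl) (false , false , refl) _  = fn-sym (ψ X) _ _
    attached-pair (true  , false , refl) (true  , true  , refl) _  = sym same-ψ
    attached-pair (true  , true  , refl) (true  , false , refl) _  = trans (fn-sym (ψ X) _ _) (sym same-ψ)
    attached-pair (false , false , refl) (false , false , refl) uv = contradiction uv (irrefl X)
    attached-pair (false , true  , refl) (false , true  , refl) uv = contradiction uv (irrefl X)
    attached-pair (true  , false , refl) (true  , false , refl) uv = contradiction uv (irrefl X)
    attached-pair (true  , true  , refl) (true  , true  , refl) uv = contradiction uv (irrefl X)
    attached-pair (false , i     , refl) (true  , j     , refl) uv = contradiction uv (apart i j)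
    attached-pair (true  , i     , refl) (false , j     , refl) uv = contradiction (adjSym X uv) (apart j i)

    -- The two cross edges have colour `not χ`, the third side has colour `χ`.
    no-triangle : ∀ {γ u v w} → IsRight u → IsLeft v → IsLeft w →
                  EdgeOf X⁺ γ u v → EdgeOf X⁺ γ u w → ¬ EdgeOf X⁺ γ v w
    no-triangle (_ , refl) (_ , refl) (_ , refl) (edge av cv) (edge aw _) (edge vw cvw) =
      not≢ (trans cv (trans (sym cvw) (attached-pair av aw vw)))

    right-clique : ∀ {γ k} {g : Fin k → Vertex} → Clique (EdgeOf X⁺ γ) g → (∀ p → IsRight (g p)) →
                   Σ (Fin k → V B) (Clique (EdgeOf B (tint χ γ)))
    right-clique {γ} {k} {g} cl allR = (λ p → ρ (proj₁ (allR p))) , λ p p′ p≢p′ → down (proj₂ (allR p)) (proj₂ (allR p′)) (cl p p′ p≢p′)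
      where
      down : ∀ {u v x y} → u ≡ inj₂ x → v ≡ inj₂ y → EdgeOf X⁺ γ u v → EdgeOf B (tint χ γ) (ρ x) (ρ y)
      down refl refl (edge a c) = edge a (trans (sym (tint-involutive χ _)) (cong (tint χ) c))

    recolour : ∀ {β γ u v} → γ ≡ β → EdgeOf B γ u v → EdgeOf B β u v
    recolour refl e = e

    no-right-clique : ∀ {γ} β → tint χ γ ≡ β → (g : Fin (3 + μ) → Vertex) → Clique (EdgeOf X⁺ γ) g → ¬ (∀ p → IsRight (g p))
    no-right-clique β eq g cl allR with right-clique cl allR
    no-right-clique true  eq g cl allR | h , clh = proj₁ B-clean h (λ p p′ p≢p′ → recolour eq (clh p p′ p≢p′))
    no-right-clique false eq g cl allR | h , clh = proj₂ B-clean (h ∘ suc)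
      (λ p p′ p≢p′ → recolour eq (clh (suc p) (suc p′) (p≢p′ ∘ Finₚ.suc-injective)))

    -- Once the clique leaves `X`, `no-triangle` allows it at most one vertex in `X`. If there is
    -- one, the colour is `not χ`, the blue of `B`, and the other m - 1 vertices contradict the
    -- cleanness of `B`.
    clique-left : ∀ {γ} (g : Fin (3 + μ) → Vertex) → Clique (EdgeOf X⁺ γ) g → ∀ p → IsLeft (g p)
    clique-left {γ} g cl with gather {P = λ p → IsLeft (g p)} {Q = Σ (Fin (3 + μ)) λ p → IsRight (g p)}
                                     (λ p → [ inj₁ , (λ R → inj₂ (p , R)) ]′ (left-or-right (g p)))
    ... | inj₁ allL    = allL
    ... | inj₂ (r , R) with gather {P = λ p → IsRight (g p)} {Q = Σ (Fin (3 + μ)) λ p → IsLeft (g p)}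
                                     (λ p → [ (λ L → inj₂ (p , L)) , inj₁ ]′ (left-or-right (g p)))
    ...   | inj₁ allR    = ⊥-elim (no-right-clique _ refl g cl allR)
    ...   | inj₂ (l , L) = ⊥-elim (proj₂ B-clean (proj₁ rest)
              λ p p′ p≢p′ → recolour blue (proj₂ rest p p′ p≢p′))
      where
      clash : ∀ {u v} → IsLeft u → IsRight v → u ≢ v
      clash (_ , refl) (_ , refl) ()
      l≢r : l ≢ r
      l≢r refl = clash L R refl
      others : ∀ p → IsRight (g (punchIn l p))
      others p with left-or-right (g (punchIn l p))
      ... | inj₂ R′ = R′
      ... | inj₁ L′ = ⊥-elim (no-triangle R L L′ (cl r l (l≢r ∘ sym))
                        (cl r _ (λ { refl → clash L′ R refl })) (cl l _ (Finₚ.punchInᵢ≢i l p ∘ sym)))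
      cross : ∀ {u v} → IsLeft u → IsRight v → EdgeOf X⁺ γ u v → tint χ γ ≡ false
      cross (_ , refl) (_ , refl) (edge _ refl) = tint-not χ
      blue : tint χ γ ≡ false
      blue = cross L R (cl l r l≢r)
      rest : Σ (Fin (2 + μ) → V B) (Clique (EdgeOf B (tint χ γ)))
      rest = right-clique (clique-∘ {R = EdgeOf X⁺ γ} {g = g} (Finₚ.punchIn-injective l _ _) cl) others

    -- The corners stay in `X` by `clique-left`; any other vertex has two adjacent corners as
    -- neighbours, so `no-triangle` keeps it there too.
    X⁺-free : ¬ Mono X⁺ (ψ X⁺)
    X⁺-free m = X-free record
      { γ = γ ; emb = λ v → proj₁ (left v)
      ; emb-inj = λ {u} {v} eq → emb-inj (trans (proj₂ (left u)) (trans (cong inj₁ eq) (sym (proj₂ (left v)))))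
      ; emb-edge = λ u v uv → down (proj₂ (left u)) (proj₂ (left v)) (emb-edge u v uv) }
      where
      open Mono m
      corners-left : ∀ p → IsLeft (emb (corner p))
      corners-left = clique-left (emb ∘ corner) (λ p p′ p≢p′ → emb-edge _ _ (corner-clique p p′ p≢p′))
      left : ∀ v → IsLeft (emb v)
      left v with two-corners v | left-or-right (emb v)
      ... | _ | inj₁ L = L
      ... | inj₁ (p , refl) | inj₂ _ = corners-left p
      ... | inj₂ (p , p′ , p≢p′ , vp , vp′) | inj₂ R =
            ⊥-elim (no-triangle R (corners-left p) (corners-left p′) (emb-edge _ _ vp) (emb-edge _ _ vp′)
                                (emb-edge _ _ (corner-clique p p′ p≢p′)))
      down : ∀ {x y u v} → x ≡ inj₁ u → y ≡ inj₁ v → EdgeOf X⁺ γ x y → EdgeOf X γ u v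
      down refl refl (edge a c) = edge a c

    module Forcing (φ : SymFun Vertex) (φ-free : ¬ Mono X⁺ φ) where

      cross : V̂ → Bool × Bool → Bool
      cross x (s , i) = fn φ (inj₁ (κ s i)) (inj₂ x)

      -- The colours towards the four ends, as one of 16 colours. A copy of K_q constant under
      -- `code` sends a single colour `α s i` to each end.
      code : V̂ → Fin _
      code x = encode ends (cross x)

      cloned = twins (λ x y → fn φ (inj₂ x) (inj₂ y)) code

      h : V B → V̂
      h = proj₁ cloned

      ρ-h : ∀ v → ρ (h v) ≡ v
      ρ-h = proj₁ (proj₂ cloned)

      copy = B-mono (code ∘ h)

      k : Fin q → V B
      k = proj₁ copy

      α : Bool → Bool → Bool
      α s i = cross (h (k core-vertex)) (s , i)

      α-const : ∀ s i a → fn φ (inj₁ (κ s i)) (inj₂ (h (k a))) ≡ α s i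
      α-const s i a = encode-injective ends (proj₂ (proj₂ copy) a core-vertex) (s , i)

      c : SymFun (Fin q)
      c = mkSym (λ a b → fn φ (inj₂ (h (k a))) (inj₂ (h (k b)))) (λ a b → fn-sym φ _ _)

      φEdge : Bool → Vertex → Vertex → Set
      φEdge = Edge _∼_ (fn φ)

      φEdge-sym : ∀ {γ} → Symmetric (φEdge γ)
      φEdge-sym = Edge-sym (λ {u} {v} → ∼-sym u v) φ

      -- The vertices that cannot tell a point from its twin: `same-p` covers the ends, `same-φ` the
      -- other points.
      data Visible : Vertex → Set where
        end   : ∀ s i → Visible (inj₁ (κ s i))
        point : ∀ a → Visible (inj₂ (h (k a)))

      -- The twin of the last vertex completes a monochromatic K_m to a copy of the target. The last
      -- vertex must be a point, since only points have twins.
      no-mono-clique : ∀ {γ} (g : Fin (3 + μ) → Vertex) → Clique (φEdge γ) g → (∀ p → Visible (g p)) →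
                       ∀ a → g (fromℕ (2 + μ)) ≢ inj₂ (h (k a))
      no-mono-clique {γ} g cl vis a last≡ =
        let emb , inj , hom = fits {E = φEdge γ} φEdge-sym (λ {v} e → ∼-irrefl v (adjacent e)) g cl (inj₂ twin)
                                   (λ eq → other (inj₂-injective (trans eq last≡)))
                                   (λ p p≢ → to-twin (vis p) (subst (φEdge γ (g p)) last≡ (cl p _ p≢)))
        in φ-free record { γ = γ ; emb = emb ; emb-inj = inj ; emb-edge = hom }
        where
        open Twin (proj₂ (proj₂ cloned) (all∈ (k a)))
        to-twin : ∀ {u} → Visible u → φEdge γ u (inj₂ (h (k a))) → φEdge γ u (inj₂ twin)
        to-twin (end s i) (edge at eq) =
          edge at (trans (encode-injective ends same-p (s , i)) eq)
        to-twin (point a′) (edge adj eq) =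
          edge (subst (Adj B (ρ (h (k a′)))) (trans (ρ-h (k a)) (sym over)) adj)
               (trans (same-φ (k a′) (λ eq′ → irrefl B (subst (λ v → Adj B (ρ (h v)) (ρ (h (k a)))) eq′ adj))) eq)

      lift-clique : ∀ {γ l} {g : Fin l → Fin q} → Clique (Pair (fn c) γ) g → Clique (φEdge γ) (inj₂ ∘ h ∘ k ∘ g)
      lift-clique cl p p′ p≢p′ =
        edge (subst₂ (Adj B) (sym (ρ-h _)) (sym (ρ-h _)) (proj₁ (proj₂ copy) _ _ (adjacent (cl p p′ p≢p′))))
             (coloured (cl p p′ p≢p′))

      _∷ᵛ_ : ∀ {l u} {g : Fin l → Vertex} → Visible u → (∀ p → Visible (g p)) → ∀ p → Visible ((u ◂ g) p)
      (vu ∷ᵛ vg) zero    = vu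
      (vu ∷ᵛ vg) (suc p) = vg p

      end-clique : ∀ {γ l s i} {g : Fin l → Fin q} → α s i ≡ γ → Clique (Pair (fn c) γ) g →
                   Clique (φEdge γ) (inj₁ (κ s i) ◂ (inj₂ ∘ h ∘ k ∘ g))
      end-clique {s = s} {i} {g} αγ cl =
        ◂-clique {R = φEdge _} φEdge-sym {v = inj₁ (κ s i)} {g = inj₂ ∘ h ∘ k ∘ g} (λ p → edge (s , i , refl) (trans (α-const s i (g p)) αγ)) (lift-clique cl)

      ε : Bool → Bool
      ε s = fn φ (inj₁ (κ s false)) (inj₁ (κ s true))

      -- By `unavoidable₂`, the core has a K_{m-2} in colour `ε s`, which both ends would extend to
      -- a K_m, or a K_m in the other colour.
      not-both : ∀ s → α s false ≡ ε s → ¬ α s true ≡ ε s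
      not-both s α₀ α₁ = unavoidable₂ c (ε s)
        -- The ends are prefixed, so the last vertex comes from `g`, which has 1 + μ vertices and is
        -- nonempty.
        (λ g cl → no-mono-clique (inj₁ (κ s false) ◂ (inj₁ (κ s true) ◂ (inj₂ ∘ h ∘ k ∘ g)))
          (◂-clique {R = φEdge _} φEdge-sym {v = inj₁ (κ s false)} {g = inj₁ (κ s true) ◂ (inj₂ ∘ h ∘ k ∘ g)} (edge₀ g) (end-clique α₁ cl))
          (end s false ∷ᵛ (end s true ∷ᵛ (point ∘ g)))
          _ refl)
        (λ g cl → no-mono-clique (inj₂ ∘ h ∘ k ∘ g) (lift-clique cl) (point ∘ g) _ refl)
        where
        edge₀ : ∀ {l} (g : Fin l → Fin q) p → φEdge (ε s) (inj₁ (κ s false)) ((inj₁ (κ s true) ◂ (inj₂ ∘ h ∘ k ∘ g)) p)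
        edge₀ g zero    = edge (ends-adjacent s) refl
        edge₀ g (suc p) = edge (s , false , refl) (trans (α-const s false (g p)) α₀)

      other-end : ∀ s → Σ Bool λ i → α s i ≡ not (ε s)
      other-end s with α s false Boolₚ.≟ ε s
      ... | no α₀   = false , Boolₚ.¬-not α₀
      ... | yes α₀  = true , Boolₚ.¬-not (not-both s α₀)

      -- If the two edges differ, the colours supplied by `other-end` differ too, so each colour is
      -- sent to the core by some end. That end extends the monochromatic K_{m-1} of `unavoidable₁`
      -- to a K_m.
      forced : ε false ≡ ε true
      forced with ε false Boolₚ.≟ ε true
      ... | yes eq = eq
      ... | no ε≢  = ⊥-elim (unavoidable₁ c λ γ g cl → hit γ g cl (reach γ))
        where
        reach : ∀ γ → Σ Bool λ s → Σ Bool λ i → α s i ≡ γ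
        reach γ with γ Boolₚ.≟ ε true
        ... | yes γ≡ = false , proj₁ (other-end false) , trans (proj₂ (other-end false)) (trans (sym (Boolₚ.¬-not (ε≢ ∘ sym))) (sym γ≡))
        ... | no γ≢  = true , proj₁ (other-end true) , trans (proj₂ (other-end true)) (sym (Boolₚ.¬-not γ≢))
        hit : ∀ γ → (g : Fin (2 + μ) → Fin q) → Clique (Pair (fn c) γ) g → ¬ (Σ Bool λ s → Σ Bool λ i → α s i ≡ γ)
        hit γ g cl (s , i , αγ) = no-mono-clique (inj₁ (κ s i) ◂ (inj₂ ∘ h ∘ k ∘ g)) (end-clique αγ cl)
                                    (end s i ∷ᵛ (point ∘ g)) _ refl

-- Assembling the gadget

does-≡ : ∀ {P : Set} {b} (P? : Dec P) → (P → b ≡ true) → (b ≡ true → P) → does P? ≡ b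
does-≡ {b = true}  (yes _) _ _ = refl
does-≡ {b = true}  (no ¬p) _ g = contradiction (g refl) ¬p
does-≡ {b = false} (yes p) f _ = sym (f p)
does-≡ {b = false} (no _)  _ _ = refl

does-true : ∀ {P : Set} (P? : Dec P) → does P? ≡ true → P
does-true (yes p) _ = p

true-does : ∀ {P : Set} (P? : Dec P) → P → does P? ≡ true
true-does (yes _) _ = refl
true-does (no ¬p) p = contradiction p ¬p

tint-true : ∀ b → tint true b ≡ b
tint-true true  = refl
tint-true false = refl

tint-false : ∀ b → tint false b ≡ not b
tint-false true  = refl
tint-false false = refl

module Assembly {ν : ℕ} (adjH : Fin (3 + ν) → Fin (3 + ν) → Bool)
                (symH : ∀ i j → adjH i j ≡ adjH j i) (irrH : ∀ i → adjH i i ≡ false)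
                {μ : ℕ} (𝒯 : Target (λ u v → adjH u v ≡ true) μ) (𝒦 : Core μ)
                (ends : Finite (Bool × Bool)) (𝒜 : Folkman.Arrowing 𝒦 (2 ^ Finite.card ends))
                (𝒞 : Cloning (ColGraph.V (Folkman.Arrowing.X 𝒜)) (2 ^ Finite.card ends)
                             (mapᴸ id (elements (ColGraph.finite (Folkman.Arrowing.X 𝒜))))) where

  open Target 𝒯
  open Gadgets 𝒯 𝒦 ends 𝒜 𝒞
  open ColGraph

  _⌢_ : Fin (3 + ν) → Fin (3 + ν) → Set
  u ⌢ v = adjH u v ≡ true

  ⌢⇒≢ : ∀ {u v} → u ⌢ v → u ≢ v
  ⌢⇒≢ {u} uv refl with trans (sym uv) (irrH u)
  ... | ()

  record _↪_ (X Y : ColGraph) : Set where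
    field
      ι     : V X → V Y
      ι-inj : ∀ {u v} → ι u ≡ ι v → u ≡ v
      ι-adj : ∀ {u v} → Adj X u v → Adj Y (ι u) (ι v)
      ι-adj⁻¹ : ∀ {u v} → Adj Y (ι u) (ι v) → Adj X u v
      ι-ψ   : ∀ u v → fn (ψ Y) (ι u) (ι v) ≡ fn (ψ X) u v
  open _↪_

  ↪-refl : ∀ {X} → X ↪ X
  ↪-refl = record { ι = id ; ι-inj = id ; ι-adj = id ; ι-adj⁻¹ = id ; ι-ψ = λ _ _ → refl }

  ↪-trans : ∀ {X Y Z} → X ↪ Y → Y ↪ Z → X ↪ Z
  ↪-trans f g = record
    { ι = ι g ∘ ι f ; ι-inj = ι-inj f ∘ ι-inj g ; ι-adj = ι-adj g ∘ ι-adj f ; ι-adj⁻¹ = ι-adj⁻¹ f ∘ ι-adj⁻¹ g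
    ; ι-ψ = λ u v → trans (ι-ψ g _ _) (ι-ψ f u v) }

  pull : ∀ {X Y} → X ↪ Y → SymFun (V Y) → SymFun (V X)
  pull f φ = mkSym (λ u v → fn φ (ι f u) (ι f v)) (λ u v → fn-sym φ _ _)

  Mono-push : ∀ {X Y} (f : X ↪ Y) {φ} → Mono X (pull f φ) → Mono Y φ
  Mono-push f m = record
    { γ = γ ; emb = ι f ∘ emb ; emb-inj = emb-inj ∘ ι-inj f
    ; emb-edge = λ u v uv → edge (ι-adj f (adjacent (emb-edge u v uv))) (coloured (emb-edge u v uv)) }
    where open Mono m

  Link-map : ∀ {X Y} → X ↪ Y → Link X → Link Y
  Link-map f ℓ = record
    { κ = λ s i → ι f (κ s i) ; ends-adjacent = λ s → ι-adj f (ends-adjacent s)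
    ; apart = λ i j → apart i j ∘ ι-adj⁻¹ f ; same-ψ = trans (ι-ψ f _ _) (trans same-ψ (sym (ι-ψ f _ _))) }
    where open Link ℓ

  record Linking {W : Set} (X : ColGraph) (ℓ : W → Link X) (ws : List W) : Set₁ where
    field
      F      : ColGraph
      F-free : ¬ Mono F (ψ F)
      inc    : X ↪ F
      linked : ∀ φ → ¬ Mono F φ → ∀ {w} → w ∈ ws → Linked (ℓ w) (pull inc φ)

  -- One link is realised at a time; the remaining ones are transported to the larger graph, where
  -- `ι-adj⁻¹` keeps their edges apart.
  linking : ∀ {W : Set} X → ¬ Mono X (ψ X) → (ℓ : W → Link X) (ws : List W) → Linking X ℓ ws
  linking X X-free ℓ []       = record { F = X ; F-free = X-free ; inc = ↪-refl ; linked = λ _ _ () }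
  linking X X-free ℓ (w ∷ ws) = record
    { F = L.F ; F-free = L.F-free ; inc = ↪-trans inl L.inc
    ; linked = λ { φ φ-free (here refl)  → A.Forcing.forced (pull L.inc φ) (φ-free ∘ Mono-push L.inc)
                 ; φ φ-free (there w∈ws) → L.linked φ φ-free w∈ws } }
    where
    module A = Attach X X-free (ℓ w)
    inl : X ↪ A.X⁺
    inl = record { ι = inj₁ ; ι-inj = λ { refl → refl } ; ι-adj = id ; ι-adj⁻¹ = id ; ι-ψ = λ _ _ → refl }
    module L = Linking (linking A.X⁺ A.X⁺-free (Link-map inl ∘ ℓ) ws)

  module _ (X Y : ColGraph) where

    _∪-adj_ : V X ⊎ V Y → V X ⊎ V Y → Set
    inj₁ u ∪-adj inj₁ v = Adj X u v
    inj₁ _ ∪-adj inj₂ _ = ⊥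
    inj₂ _ ∪-adj inj₁ _ = ⊥
    inj₂ u ∪-adj inj₂ v = Adj Y u v

    ∪-adj? : ∀ u v → Dec (u ∪-adj v)
    ∪-adj? (inj₁ u) (inj₁ v) = adj? X u v
    ∪-adj? (inj₁ _) (inj₂ _) = no λ ()
    ∪-adj? (inj₂ _) (inj₁ _) = no λ ()
    ∪-adj? (inj₂ u) (inj₂ v) = adj? Y u v

    ∪-sym : ∀ u v → u ∪-adj v → v ∪-adj u
    ∪-sym (inj₁ _) (inj₁ _) = adjSym X
    ∪-sym (inj₂ _) (inj₂ _) = adjSym Y

    ∪-irrefl : ∀ u → ¬ u ∪-adj u
    ∪-irrefl (inj₁ _) = irrefl X
    ∪-irrefl (inj₂ _) = irrefl Y

    ∪-colour : V X ⊎ V Y → V X ⊎ V Y → Bool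
    ∪-colour (inj₁ u) (inj₁ v) = fn (ψ X) u v
    ∪-colour (inj₁ _) (inj₂ _) = true
    ∪-colour (inj₂ _) (inj₁ _) = true
    ∪-colour (inj₂ u) (inj₂ v) = fn (ψ Y) u v

    ∪-colour-sym : ∀ u v → ∪-colour u v ≡ ∪-colour v u
    ∪-colour-sym (inj₁ _) (inj₁ _) = fn-sym (ψ X) _ _
    ∪-colour-sym (inj₁ _) (inj₂ _) = refl
    ∪-colour-sym (inj₂ _) (inj₁ _) = refl
    ∪-colour-sym (inj₂ _) (inj₂ _) = fn-sym (ψ Y) _ _

    _∪_ : ColGraph
    _∪_ = record
      { V = V X ⊎ V Y ; finite = ⊎-finite (finite X) (finite Y) ; Adj = _∪-adj_ ; adj? = ∪-adj?
      ; adjSym = λ {u} {v} → ∪-sym u v ; irrefl = λ {u} → ∪-irrefl u ; ψ = mkSym ∪-colour ∪-colour-sym }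

    ∪-inj₁ : X ↪ _∪_
    ∪-inj₁ = record { ι = inj₁ ; ι-inj = λ { refl → refl } ; ι-adj = id ; ι-adj⁻¹ = id ; ι-ψ = λ _ _ → refl }

    ∪-inj₂ : Y ↪ _∪_
    ∪-inj₂ = record { ι = inj₂ ; ι-inj = λ { refl → refl } ; ι-adj = id ; ι-adj⁻¹ = id ; ι-ψ = λ _ _ → refl }

    Mono-restrict : ∀ {Z} (f : Z ↪ _∪_) (m : Mono _∪_ (ψ _∪_)) → (∀ v → Σ (V Z) λ z → Mono.emb m v ≡ ι f z) → Mono Z (ψ Z)
    Mono-restrict {Z} f m all = record
      { γ = γ ; emb = λ v → proj₁ (all v)
      ; emb-inj = λ {u} {v} eq → emb-inj (trans (proj₂ (all u)) (trans (cong (ι f) eq) (sym (proj₂ (all v)))))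
      ; emb-edge = λ u v uv → down (proj₂ (all u)) (proj₂ (all v)) (emb-edge u v uv) }
      where
      open Mono m
      down : ∀ {u v x y} → u ≡ ι f x → v ≡ ι f y → EdgeOf _∪_ γ u v → EdgeOf Z γ x y
      down refl refl (edge a c) = edge (ι-adj⁻¹ f a) (trans (sym (ι-ψ f _ _)) c)

    -- Every vertex is the hub or adjacent to it, so a copy lies in the component that contains the
    -- image of the hub.
    ∪-free : ¬ Mono X (ψ X) → ¬ Mono Y (ψ Y) → ¬ Mono _∪_ (ψ _∪_)
    ∪-free X-free Y-free m = split (emb hub) refl
      where
      open Mono m
      near₁ : ∀ {u v x} → u ≡ inj₁ x → u ∪-adj v → Σ (V X) λ y → v ≡ inj₁ y
      near₁ {v = inj₁ y} refl _ = y , refl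
      near₂ : ∀ {u v x} → u ≡ inj₂ x → u ∪-adj v → Σ (V Y) λ y → v ≡ inj₂ y
      near₂ {v = inj₂ y} refl _ = y , refl
      split : ∀ w → emb hub ≡ w → ⊥
      split (inj₁ x) eq = X-free (Mono-restrict ∪-inj₁ m λ v →
        [ (λ { refl → x , eq }) , (λ hv → near₁ eq (adjacent (emb-edge hub v hv))) ]′ (hub-adjacent v))
      split (inj₂ x) eq = Y-free (Mono-restrict ∪-inj₂ m λ v →
        [ (λ { refl → x , eq }) , (λ hv → near₂ eq (adjacent (emb-edge hub v hv))) ]′ (hub-adjacent v))

  -- A blue star at `zero`, everything else red, on exactly as many vertices as the target.
  star : SymFun (Fin (3 + ν))
  star = joined false (mkSym (λ _ _ → true) (λ _ _ → refl))

  D : ColGraph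
  D = complete star

  star-false : ∀ u v → fn star u v ≡ false → u ≡ zero ⊎ v ≡ zero
  star-false zero    _    _ = inj₁ refl
  star-false (suc _) zero _ = inj₂ refl

  -- By counting, a copy uses all vertices, including the centre of the star. The preimage of the
  -- centre has a neighbour, so the copy is blue; but three corners form a triangle, and a star
  -- contains none.
  D-free : ¬ Mono D (ψ D)
  D-free m with Finₚ.any? (λ i → emb i Finₚ.≟ zero)
    where open Mono m
  ... | no ¬0 = ℕₚ.1+n≰n (Finₚ.injective⇒≤ {f = λ i → punchOut {i = zero} (λ 0≡ → ¬0 (i , sym 0≡))}
                   (λ eq → emb-inj (Finₚ.punchOut-injective {i = zero} _ _ eq)))
    where open Mono m
  ... | yes (i , i↦0) = two-zeros (star-false _ _ (side 0≢1)) (star-false _ _ (side 0≢2)) (star-false _ _ (side 1≢2))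
    where
    open Mono m
    neighbour : Σ (Fin (3 + ν)) (i ⌢_)
    neighbour with two-corners i
    ... | inj₁ (p , refl) = corner (punchIn p zero) , corner-clique p _ (Finₚ.punchInᵢ≢i p zero ∘ sym)
    ... | inj₂ (p , _ , _ , ip , _) = corner p , ip
    γ≡false : γ ≡ false
    γ≡false = trans (sym (coloured (emb-edge i _ (proj₂ neighbour)))) (cong (λ u → fn star u (emb (proj₁ neighbour))) i↦0)
    e : Fin (3 + μ) → Fin (3 + ν)
    e = emb ∘ corner
    0≢1 : zero ≢ Fin.suc {2 + μ} zero
    0≢1 ()
    0≢2 : zero ≢ Fin.suc {2 + μ} (suc zero)
    0≢2 ()
    1≢2 : suc zero ≢ Fin.suc {2 + μ} (suc zero)
    1≢2 ()
    side : ∀ {p p′} → p ≢ p′ → fn star (e p) (e p′) ≡ false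
    side p≢p′ = trans (coloured (emb-edge _ _ (corner-clique _ _ p≢p′))) γ≡false
    clash : ∀ {p p′} → p ≢ p′ → e p ≡ zero → e p′ ≡ zero → ⊥
    clash p≢p′ p0 p′0 = adjacent (emb-edge _ _ (corner-clique _ _ p≢p′)) (trans p0 (sym p′0))
    two-zeros : e zero ≡ zero ⊎ e (suc zero) ≡ zero → e zero ≡ zero ⊎ e (suc (suc zero)) ≡ zero →
                e (suc zero) ≡ zero ⊎ e (suc (suc zero)) ≡ zero → ⊥
    two-zeros (inj₁ a) _        (inj₁ b) = clash 0≢1 a b
    two-zeros (inj₁ a) _        (inj₂ c) = clash 0≢2 a c
    two-zeros (inj₂ b) (inj₁ a) _        = clash 0≢1 a b
    two-zeros (inj₂ b) (inj₂ c) _        = clash 1≢2 b c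

  Hᴳ : Graph
  Hᴳ = record { n = 3 + ν ; adj = adjH ; sym = symH ; irref = irrH }

  module Host (G : Graph) (ψG : Coloring G) where

    private
      module G = Graph G

    X : ColGraph
    X = record
      { V = Fin G.n ; finite = Fin-finite ; Adj = λ i j → G.adj i j ≡ true
      ; adj? = λ i j → G.adj i j Boolₚ.≟ true
      ; adjSym = λ {i} {j} ij → trans (G.sym j i) ij
      ; irrefl = λ {i} ii → false≢true (trans (sym (G.irref i)) ii)
      ; ψ = mkSym (Coloring.col ψG) (Coloring.colSym ψG) }
      where
      false≢true : false ≢ true
      false≢true ()

    X-free : HFree Hᴳ G ψG → ¬ Mono X (ψ X)
    X-free ψG-free m = ψG-free
      ( record { emb = emb ; embInj = emb-inj ; embHom = λ u v uv → adjacent (emb-edge u v uv) }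
      , γ , λ u v uv → coloured (emb-edge u v uv))
      where open Mono m

    -- The edges of this copy of `D` are linked as well: they follow the references, which forces
    -- the references to differ. The references sit in a further disjoint copy to guarantee `apart`.
    X∪D : ColGraph
    X∪D = X ∪ D

    -- The second copy of D holds one reference edge of each colour.
    ref : Bool → Bool → Fin (3 + ν)
    ref true  false = suc zero
    ref true  true  = suc (suc zero)
    ref false false = zero
    ref false true  = suc zero

    ref-≢ : ∀ b → ref b false ≢ ref b true
    ref-≢ true  ()
    ref-≢ false ()

    ref-ψ : ∀ b → b ≡ fn star (ref b false) (ref b true)
    ref-ψ true  = refl
    ref-ψ false = refl

    toRef : ∀ u v → Adj X∪D u v → Link (X∪D ∪ D)
    toRef u v uv = record
      { κ = λ { false false → inj₁ u ; false true → inj₁ v ; true i → inj₂ (ref b i) }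
      ; ends-adjacent = λ { false → uv ; true → ref-≢ b }
      ; apart = λ { false _ () ; true _ () }
      ; same-ψ = ref-ψ b }
      where b = fn (ψ X∪D) u v

    link : V X∪D × V X∪D → Link (X∪D ∪ D)
    link (u , v) with adj? X∪D u v
    ... | yes uv = toRef u v uv
    -- A default edge of the first `D` for non-adjacent pairs, so that the list can run over all
    -- pairs.
    ... | no _   = toRef (inj₂ zero) (inj₂ (suc zero)) (λ ())

    pairs : List (V X∪D × V X∪D)
    pairs = elements (×-finite (finite X∪D) (finite X∪D))

    module Closed (𝓛 : Linking (X∪D ∪ D) link pairs) where

      open Linking 𝓛

      module F = ColGraph F

      Fᴳ : Graph
      Fᴳ = record
        { n     = F.card
        ; adj   = λ i j → does (F.adj? (F.fromIndex i) (F.fromIndex j))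
        ; sym   = λ i j → does-≡ (F.adj? _ _) (true-does (F.adj? _ _) ∘ F.adjSym) (F.adjSym ∘ does-true (F.adj? _ _))
        ; irref = λ i → does-≡ (F.adj? _ _) (λ ii → contradiction ii F.irrefl) (λ ()) }

      base : X ↪ F
      base = ↪-trans (∪-inj₁ X D) (↪-trans (∪-inj₁ X∪D D) inc)

      toIndex-inj : ∀ {u v} → F.toIndex u ≡ F.toIndex v → u ≡ v
      toIndex-inj {u} {v} eq = trans (sym (F.fromIndex-toIndex u)) (trans (cong F.fromIndex eq) (F.fromIndex-toIndex v))

      fromIndex-inj : ∀ {i j} → F.fromIndex i ≡ F.fromIndex j → i ≡ j
      fromIndex-inj {i} {j} eq = trans (sym (F.toIndex-fromIndex i)) (trans (cong F.toIndex eq) (F.toIndex-fromIndex j))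

      round : ∀ {u v} → F.Adj u v → F.Adj (F.fromIndex (F.toIndex u)) (F.fromIndex (F.toIndex v))
      round = subst₂ F.Adj (sym (F.fromIndex-toIndex _)) (sym (F.fromIndex-toIndex _))

      round⁻¹ : ∀ {u v} → F.Adj (F.fromIndex (F.toIndex u)) (F.fromIndex (F.toIndex v)) → F.Adj u v
      round⁻¹ = subst₂ F.Adj (F.fromIndex-toIndex _) (F.fromIndex-toIndex _)

      induced : InducedEmb G Fᴳ
      induced = record
        { map    = F.toIndex ∘ ι base
        ; mapInj = ι-inj base ∘ toIndex-inj
        ; mapInd = λ i j → does-≡ (F.adj? _ _) (ι-adj⁻¹ base ∘ round⁻¹) (round ∘ ι-adj base) }

      good : ¬ Defs.Arrows Fᴳ Hᴳ
      good arrows with arrows (record { col    = λ i j → fn F.ψ (F.fromIndex i) (F.fromIndex j)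
                                      ; colSym = λ i j → fn-sym F.ψ _ _ })
      ... | f , γ , mono = F-free record
        { γ = γ ; emb = F.fromIndex ∘ Copy.emb f ; emb-inj = Copy.embInj f ∘ fromIndex-inj
        ; emb-edge = λ u v uv → edge (does-true (F.adj? _ _) (Copy.embHom f u v uv)) (mono u v uv) }

      module _ (φ : Coloring Fᴳ) (φ-free : HFree Hᴳ Fᴳ φ) where

        φ̂ : SymFun F.V
        φ̂ = mkSym (λ u v → Coloring.col φ (F.toIndex u) (F.toIndex v)) (λ u v → Coloring.colSym φ _ _)

        φ̂-free : ¬ Mono F φ̂
        φ̂-free m = φ-free
          ( record { emb = F.toIndex ∘ emb ; embInj = emb-inj ∘ toIndex-inj
                   ; embHom = λ u v uv → true-does (F.adj? _ _) (round (adjacent (emb-edge u v uv))) }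
          , γ , λ u v uv → coloured (emb-edge u v uv))
          where open Mono m

        refColour : Bool → Bool
        refColour b = fn (pull inc φ̂) (inj₂ (ref b false)) (inj₂ (ref b true))

        follows : ∀ u v → Adj X∪D u v → fn (pull inc φ̂) (inj₁ u) (inj₁ v) ≡ refColour (fn (ψ X∪D) u v)
        follows u v uv = unfold (linked φ̂ φ̂-free (∈-elements (×-finite (finite X∪D) (finite X∪D)) (u , v)))
          where
          unfold : Linked (link (u , v)) (pull inc φ̂) → fn (pull inc φ̂) (inj₁ u) (inj₁ v) ≡ refColour (fn (ψ X∪D) u v)
          unfold with adj? X∪D u v
          ... | yes _   = id
          ... | no ¬uv  = contradiction uv ¬uv

        -- Equal references would make the first copy of `D` monochromatic, and the target embeds
        -- into this complete graph by the identity.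
        refColour-≢ : refColour true ≢ refColour false
        refColour-≢ eq = φ̂-free (Mono-push (↪-trans (∪-inj₂ X D) (↪-trans (∪-inj₁ X∪D D) inc)) record
          { γ = refColour true ; emb = id ; emb-inj = id
          ; emb-edge = λ u v uv → edge (⌢⇒≢ uv) (trans (follows (inj₂ u) (inj₂ v) (⌢⇒≢ uv)) (either (fn star u v))) })
          where
          either : ∀ b → refColour b ≡ refColour true
          either true  = refl
          either false = sym eq

        tinted : ∀ b → refColour b ≡ tint (refColour true) b
        tinted true  = refl
        tinted false = Boolₚ.¬-not (refColour-≢ ∘ sym)

        agrees : AgreeUpToSwap G Fᴳ induced φ ψG
        agrees = agree (refColour true) λ i j ij → trans (follows (inj₁ i) (inj₁ j) ij) (tinted _)
          where
          agree : ∀ χ → (∀ i j → G.adj i j ≡ true → fn φ̂ (ι base i) (ι base j) ≡ tint χ (Coloring.col ψG i j)) →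
                  AgreeUpToSwap G Fᴳ induced φ ψG
          agree true  eq = inj₁ λ i j ij → trans (eq i j ij) (tint-true (Coloring.col ψG i j))
          agree false eq = inj₂ λ i j ij → trans (eq i j ij) (tint-false (Coloring.col ψG i j))

  gadgets : HasBELGadgets Hᴳ
  gadgets G ψG ψG-free = Fᴳ , good , induced , agrees
    where
    open Host G ψG
    open Closed (linking (X∪D ∪ D) (∪-free X∪D D (∪-free X D (X-free ψG-free) D-free) D-free) link pairs)

-- The graphs H_{t,d}

-- The symmetrised adjacency of `H t d` before loops are removed, in a form suited to matching.
data Touch (t d : ℕ) : ℕ → ℕ → Set where
  inside : ∀ {x y} → x < t → y < t → Touch t d x y
  spoke  : ∀ {y} → y < d → Touch t d t y
  spoke′ : ∀ {x} → x < d → Touch t d x t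

flip-Touch : ∀ {t d x y} → Touch t d x y → Touch t d y x
flip-Touch (inside x< y<) = inside y< x<
flip-Touch (spoke y<)     = spoke′ y<
flip-Touch (spoke′ x<)    = spoke x<

module _ (t d : ℕ) where

  private
    link : ℕ → ℕ → Bool
    link x y = ((x <ᵇ t) ∧ (y <ᵇ t)) ∨ ((x ≡ᵇ t) ∧ (y <ᵇ d))

    link⇒Touch : ∀ x y → T (link x y) → Touch t d x y
    link⇒Touch x y l with Equivalence.to T-∨ l
    ... | inj₁ xy = let x< , y< = Equivalence.to T-∧ xy in inside (ℕₚ.<ᵇ⇒< x t x<) (ℕₚ.<ᵇ⇒< y t y<)
    ... | inj₂ xy with Equivalence.to T-∧ xy
    ...   | x≡t , y< with ℕₚ.≡ᵇ⇒≡ x t x≡t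
    ...     | refl = spoke (ℕₚ.<ᵇ⇒< y d y<)

    inside-link : ∀ {x y} → x < t → y < t → T (link x y)
    inside-link x< y< = Equivalence.from T-∨ (inj₁ (Equivalence.from T-∧ (ℕₚ.<⇒<ᵇ x< , ℕₚ.<⇒<ᵇ y<)))

    spoke-link : ∀ {y} → y < d → T (link t y)
    spoke-link y< = Equivalence.from T-∨ (inj₂ (Equivalence.from T-∧ (ℕₚ.≡⇒≡ᵇ t t refl , ℕₚ.<⇒<ᵇ y<)))

    Touch⇒link : ∀ {x y} → Touch t d x y → T (link x y) ⊎ T (link y x)
    Touch⇒link (inside x< y<) = inj₁ (inside-link x< y<)
    Touch⇒link (spoke y<)     = inj₁ (spoke-link y<)
    Touch⇒link (spoke′ x<)    = inj₂ (spoke-link x<)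

  H-adj : Fin (suc t) → Fin (suc t) → Bool
  H-adj = Defs.adj (H t d)

  H-adj⇒ : ∀ u v → H-adj u v ≡ true → u ≢ v × Touch t d (toℕ u) (toℕ v)
  H-adj⇒ u v uv with Equivalence.to T-∧ (Equivalence.from T-≡ uv)
  ... | u≢v , l = (λ { refl → distinct (ℕₚ.≡⇒≡ᵇ (toℕ u) (toℕ u) refl) u≢v })
                , [ link⇒Touch _ _ , flip-Touch ∘ link⇒Touch _ _ ]′ (Equivalence.to T-∨ l)
    where
    distinct : ∀ {b} → T b → ¬ T (not b)
    distinct {true} _ ()

  H-adj⇐ : ∀ {u v} → u ≢ v → Touch t d (toℕ u) (toℕ v) → H-adj u v ≡ true
  H-adj⇐ {u} {v} u≢v touch = Equivalence.to T-≡ (Equivalence.from T-∧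
    (distinct (u≢v ∘ Finₚ.toℕ-injective ∘ ℕₚ.≡ᵇ⇒≡ (toℕ u) (toℕ v)) , Equivalence.from T-∨ (Touch⇒link touch)))
    where
    distinct : ∀ {b} → ¬ T b → T (not b)
    distinct {true}  ¬t = ¬t _
    distinct {false} _  = _

clique-injective : ∀ {V : Set} {E : V → V → Set} → (∀ {v} → ¬ E v v) → ∀ {k} {g : Fin k → V} → Clique E g →
                   ∀ {i j} → g i ≡ g j → i ≡ j
clique-injective {E = E} irr {g = g} cl {i} {j} eq with i Finₚ.≟ j
... | yes i≡j = i≡j
... | no i≢j  = contradiction (subst (λ v → E v (g j)) eq (cl i j i≢j)) irr

-- Here d = t and m = t + 1: all vertices are corners, and a K_m is already a copy of `H`.
complete-target : ∀ τ → Target (λ u v → H-adj (2 + τ) (2 + τ) u v ≡ true) τ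
complete-target τ = record
  { corner        = id
  ; corner-clique = all-adjacent
  ; two-corners   = λ v → inj₁ (v , refl)
  ; hub           = zero
  ; hub-adjacent  = hub-adjacent
  ; fits          = λ {_} {E} _ irr g cl _ _ _ → g , clique-injective {E = E} irr cl , λ u v uv → cl u v (proj₁ (H-adj⇒ (2 + τ) (2 + τ) u v uv))
  }
  where
  touch : ∀ {x y} → x ≢ y → x < 3 + τ → y < 3 + τ → Touch (2 + τ) (2 + τ) x y
  touch {x} {y} x≢y (s≤s x≤) (s≤s y≤) with ℕₚ.m≤n⇒m<n∨m≡n x≤ | ℕₚ.m≤n⇒m<n∨m≡n y≤
  ... | inj₁ x<   | inj₁ y<   = inside x< y<
  ... | inj₁ x<   | inj₂ refl = spoke′ x<
  ... | inj₂ refl | inj₁ y<   = spoke y<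
  ... | inj₂ refl | inj₂ refl = contradiction refl x≢y

  all-adjacent : ∀ u v → u ≢ v → H-adj (2 + τ) (2 + τ) u v ≡ true
  all-adjacent u v u≢v = H-adj⇐ (2 + τ) (2 + τ) u≢v (touch (u≢v ∘ Finₚ.toℕ-injective) (Finₚ.toℕ<n u) (Finₚ.toℕ<n v))

  hub-adjacent : ∀ v → v ≡ zero ⊎ H-adj (2 + τ) (2 + τ) zero v ≡ true
  hub-adjacent zero    = inj₁ refl
  hub-adjacent (suc v) = inj₂ (all-adjacent zero (suc v) λ ())

-- Here d < t and m = t. The additional vertex misses the last corner, as d is at most 2 + μ, so it
-- can be placed at the twin `z`, which is joined to all the other corners.
pendant-target : ∀ μ d → 2 ≤ d → d ≤ 2 + μ → Target (λ u v → H-adj (3 + μ) d u v ≡ true) μ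
pendant-target μ d 2≤d d≤ = record
  { corner        = inject₁
  ; corner-clique = corner-clique
  ; two-corners   = two-corners
  ; hub           = zero
  ; hub-adjacent  = hub-adjacent
  ; fits          = fits
  }
  where
  t = 3 + μ

  top : Fin (suc t)
  top = fromℕ t

  corner<t : ∀ (p : Fin t) → toℕ (inject₁ p) < t
  corner<t p = subst (_< t) (sym (Finₚ.toℕ-inject₁ p)) (Finₚ.toℕ<n p)

  corner-clique : Clique (λ u v → H-adj t d u v ≡ true) inject₁
  corner-clique p p′ p≢p′ = H-adj⇐ t d (p≢p′ ∘ Finₚ.inject₁-injective) (inside (corner<t p) (corner<t p′))

  top≢corner : ∀ {p : Fin t} → top ≢ inject₁ p
  top≢corner = Finₚ.fromℕ≢inject₁

  spoke-adjacent : ∀ {p : Fin t} → toℕ p < d → H-adj t d top (inject₁ p) ≡ true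
  spoke-adjacent {p} p<d = H-adj⇐ t d {top} {inject₁ p} top≢corner
    (subst₂ (Touch t d) (sym (Finₚ.toℕ-fromℕ t)) (sym (Finₚ.toℕ-inject₁ p)) (spoke p<d))

  two-corners : ∀ v → (Σ (Fin t) λ p → v ≡ inject₁ p) ⊎
                (Σ (Fin t) λ p → Σ (Fin t) λ p′ → p ≢ p′ × H-adj t d v (inject₁ p) ≡ true × H-adj t d v (inject₁ p′) ≡ true)
  two-corners v with view v
  ... | ‵inject₁ p = inj₁ (p , refl)
  ... | ‵fromℕ     = inj₂ (zero , suc zero , (λ ()) , spoke-adjacent (ℕₚ.<-≤-trans (s≤s z≤n) 2≤d) , spoke-adjacent 2≤d)

  hub-adjacent : ∀ v → v ≡ zero ⊎ H-adj t d zero v ≡ true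
  hub-adjacent zero    = inj₁ refl
  hub-adjacent (suc v) = inj₂ (hub-view (suc v) (view (suc v)) λ ())
    where
    hub-view : ∀ v → View v → zero ≢ v → H-adj t d zero v ≡ true
    hub-view _ (‵inject₁ p) 0≢p = H-adj⇐ t d 0≢p (inside (s≤s z≤n) (corner<t p))
    hub-view _ ‵fromℕ       0≢t = H-adj⇐ t d 0≢t
      (subst (Touch t d 0) (sym (Finₚ.toℕ-fromℕ t)) (spoke′ (ℕₚ.<-≤-trans (s≤s z≤n) 2≤d)))

  fits : ∀ {V : Set} {E : V → V → Set} → Symmetric E → (∀ {v} → ¬ E v v) → (g : Fin t → V) → Clique E g →
         ∀ z → z ≢ g (fromℕ (2 + μ)) → (∀ p → p ≢ fromℕ (2 + μ) → E (g p) z) →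
         Σ (Fin (suc t) → V) λ emb → (∀ {u v} → emb u ≡ emb v → u ≡ v) × (∀ u v → H-adj t d u v ≡ true → E (emb u) (emb v))
  fits {V} {E} E-sym irr g cl z z≢ Ez = emb , emb-inj , emb-hom
    where
    place : ∀ {u : Fin (suc t)} → View u → V
    place (‵inject₁ p) = g p
    place ‵fromℕ       = z

    emb : Fin (suc t) → V
    emb u = place (view u)

    g≢z : ∀ p → g p ≢ z
    g≢z p eq with p Finₚ.≟ fromℕ (2 + μ)
    ... | yes refl = z≢ (sym eq)
    ... | no p≢    = irr (subst (λ v → E v z) eq (Ez p p≢))

    emb-inj : ∀ {u v} → emb u ≡ emb v → u ≡ v
    emb-inj {u} {v} eq with view u | view v
    ... | ‵inject₁ p | ‵inject₁ p′ = cong inject₁ (clique-injective {E = E} irr cl eq)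
    ... | ‵inject₁ p | ‵fromℕ      = contradiction eq (g≢z p)
    ... | ‵fromℕ     | ‵inject₁ p′ = contradiction (sym eq) (g≢z p′)
    ... | ‵fromℕ     | ‵fromℕ      = refl

    not-last : ∀ {p : Fin t} → Touch t d (toℕ (inject₁ p)) (toℕ top) → p ≢ fromℕ (2 + μ)
    not-last {p} touch refl = last (subst₂ (Touch t d)
        (trans (Finₚ.toℕ-inject₁ p) (Finₚ.toℕ-fromℕ (2 + μ))) (Finₚ.toℕ-fromℕ t) touch)
      where
      last : ¬ Touch t d (2 + μ) (3 + μ)
      last (inside _ t<t) = ℕₚ.<-irrefl refl t<t
      last (spoke′ l<d)   = ℕₚ.<-irrefl refl (ℕₚ.<-≤-trans l<d d≤)

    emb-hom : ∀ u v → H-adj t d u v ≡ true → E (emb u) (emb v)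
    emb-hom u v uv with H-adj⇒ t d u v uv | view u | view v
    ... | u≢v , _     | ‵inject₁ p | ‵inject₁ p′ = cl p p′ (u≢v ∘ cong inject₁)
    ... | _   , touch | ‵inject₁ p | ‵fromℕ      = Ez p (not-last touch)
    ... | _   , touch | ‵fromℕ     | ‵inject₁ p′ = E-sym (Ez p′ (not-last (flip-Touch touch)))
    ... | u≢v , _     | ‵fromℕ     | ‵fromℕ      = contradiction refl u≢v

gadgets-from-target : ∀ ν d {μ} → Target (λ u v → H-adj (2 + ν) d u v ≡ true) μ → HasBELGadgets (H (2 + ν) d)
gadgets-from-target ν d {μ} 𝒯 = build (core μ) (×-finite Bool-finite Bool-finite)
  where
  build : Core μ → Finite (Bool × Bool) → HasBELGadgets (H (2 + ν) d)
  build 𝒦 ends = clone (Folkman.arrowing 𝒦 _)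
    where
    clone : Folkman.Arrowing 𝒦 (2 ^ Finite.card ends) → HasBELGadgets (H (2 + ν) d)
    clone 𝒜 = Assembly.gadgets (H-adj (2 + ν) d) (Defs.sym (H (2 + ν) d)) (Defs.irref (H (2 + ν) d)) 𝒯 𝒦 ends 𝒜
                (cloning (ColGraph.finite X) _ id _)
      where open Folkman.Arrowing 𝒜

theorem3p4 : (t d : ℕ) → 2 ≤ d → d ≤ t → HasBELGadgets (H t d)
theorem3p4 (suc (suc τ)) d 2≤d d≤t with ℕₚ.m≤n⇒m<n∨m≡n d≤t
... | inj₂ refl = gadgets-from-target τ d (complete-target τ)
-- From 2 ≤ d < t follows t ≥ 3, which is why m can be written as 3 + μ.
theorem3p4 (suc (suc (suc μ))) d 2≤d d≤t | inj₁ (s≤s d≤) = gadgets-from-target (suc μ) d (pendant-target μ d 2≤d d≤)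
theorem3p4 (suc (suc zero)) d 2≤d d≤t | inj₁ (s≤s d≤1) = contradiction (ℕₚ.≤-trans 2≤d d≤1) (λ { (s≤s ()) })
theorem3p4 (suc zero) d 2≤d d≤1 = contradiction (ℕₚ.≤-trans 2≤d d≤1) (λ { (s≤s ()) })
theorem3p4 zero d 2≤d d≤0 = contradiction (ℕₚ.≤-trans 2≤d d≤0) (λ ())
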